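{- Let $p$ be a prime and $e > 0$. The distinct elementary divisors of $A_{p^e}$ are $p^i$ for $0 \le i \le e$, and the multiplicity of $p^i$ among the elementary divisors is $\phi(p^{e-i})$.
   Context: For a positive integer $k$, let $\Phi_d$ denote the $d$th cyclotomic polynomial and let $\Psi_k : \mathbf{Z}[X]/(X^k-1) \to \bigoplus_{d \mid k} \mathbf{Z}[X]/(\Phi_d(X))$ be the natural map $f \bmod (X^k-1) \mapsto \bigoplus_{d\mid k} f \bmod \Phi_d(X)$. Endow $\mathbf{Z}[X]/(X^k-1)$ with the basis $(1, \overline{X}, \dots, \overline{X}^{k-1})$, each $\mathbf{Z}[X]/(\Phi_d(X))$ with the basis $(1, \overline{X}, \dots, \overline{X}^{\phi(d)-1})$, and order the summands by increasing $d$. $A_k$ is the $k\times k$ integer matrix of $\Psi_k$ with respect to these bases. Elementary divisors are those of the Smith normal form over $\mathbf{Z}$, taken non-negative; $\phi$ is Euler's totient function. -}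

module Defs where

open import Algebra.Properties.CommutativeMonoid.Sum using (sum)
open import Data.Fin as Fin using (Fin; toℕ)
open import Data.Integer as ℤ using (ℤ; +_; 0ℤ; 1ℤ; -1ℤ)
open import Data.Integer.Properties using (+-0-commutativeMonoid)
open import Data.List as List using (List; []; _∷_; _++_; [_]; length; filter; upTo; concatMap)
open import Data.List.Membership.Propositional using (find; lose) renaming (_∈_ to _∈ₗ_)
open import Data.List.Membership.Propositional.Properties using (∈-map⁺; ∈-map⁻; ∈-filter⁺; ∈-filter⁻; ∈-upTo⁺; ∈-upTo⁻; ∈-concatMap⁺; ∈-concatMap⁻)
open import Data.List.Membership.Propositional.Properties.WithK using (unique∧set⇒bag)
open import Data.List.Properties using (length-map; length-++; length-upTo)
open import Data.List.Relation.Binary.BagAndSetEquality using (∼bag⇒↭)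
open import Data.List.Relation.Binary.Permutation.Propositional.Properties using (↭-length)
open import Data.List.Relation.Unary.All using (universal)
import Data.List.Relation.Unary.All.Properties as All
import Data.List.Relation.Unary.AllPairs as AllPairs
import Data.List.Relation.Unary.AllPairs.Properties as AllPairs
open import Data.List.Relation.Unary.Unique.Propositional using (Unique)
import Data.List.Relation.Unary.Unique.Propositional.Properties as Unique
open import Data.Nat as ℕ using (ℕ; zero; suc; _∸_)
import Data.Nat.Properties as ℕ
open import Data.Nat.Coprimality using (Coprime; coprime?; coprime⇒gcd≡1; gcd≡1⇒coprime)
open import Data.Nat.Divisibility using (_∣_; _∣?_; divides; quotient; ∣⇒≤)
open import Data.Nat.GCD using (gcd; gcd[m,n]∣m; gcd[m,n]∣n; gcd[m,n]≡0⇒n≡0; c*gcd[m,n]≡gcd[cm,cn])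
open import Data.Product using (Σ; ∃; _×_; _,_; proj₁; proj₂)
open import Data.Vec as Vec using (Vec; []; _∷_; lookup)
open import Function using (_∘_; mk⇔)
open import Relation.Binary.PropositionalEquality using (_≡_; refl; sym; trans; cong; cong₂; subst; module ≡-Reasoning)
open import Relation.Nullary using (yes; no)

[1‥_] : ℕ → List ℕ
[1‥ n ] = List.map suc (upTo n)

divisors : ℕ → List ℕ
divisors n = filter (_∣? n) [1‥ n ]

properDivisors : ℕ → List ℕ
properDivisors n = filter (_∣? n) [1‥ n ∸ 1 ]

totatives : ℕ → List ℕ
totatives n = filter (λ a → coprime? a n) [1‥ n ]

φ : ℕ → ℕ
φ n = length (totatives n)

-- Coefficients in order of increasing degree.
Poly : Set
Poly = List ℤ

coeff : Poly → ℕ → ℤ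
coeff []      _       = 0ℤ
coeff (a ∷ f) zero    = a
coeff (a ∷ f) (suc i) = coeff f i

X^_ : ℕ → Poly
X^ j = List.replicate j 0ℤ ++ [ 1ℤ ]

-- (n , c₀ ∷ … ∷ cₙ₋₁ ∷ []) stands for Xⁿ + cₙ₋₁ Xⁿ⁻¹ + … + c₀.
Monic : Set
Monic = Σ ℕ (Vec ℤ)

toPoly : Monic → Poly
toPoly (_ , c) = Vec.toList c ++ [ 1ℤ ]

-- Quotient and remainder by a monic g = Xⁿ + c.  If f = q g + r with
-- deg r < n and t is the coefficient of Xⁿ in a + X r, then
-- a + X f = (t + X q) g + (a + X r - t g).
divMod : ∀ {n} → Vec ℤ n → Poly → Poly × Vec ℤ n
divMod c []      = [] , Vec.replicate _ 0ℤ
divMod c (a ∷ f) =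
  let q , r = divMod c f
      t     = Vec.last (a ∷ r)
  in  t ∷ q , Vec.zipWith ℤ._-_ (Vec.init (a ∷ r)) (Vec.map (t ℤ.*_) c)

_mod_ : Poly → Monic → Poly
f mod (_ , c) = Vec.toList (proj₂ (divMod c f))

-- The quotient of monic polynomials of degrees m ≥ n is monic of
-- degree m - n.
_÷_ : Monic → Monic → Monic
(m , b) ÷ (n , c) =
  m ∸ n , Vec.tabulate (coeff (proj₁ (divMod c (toPoly (m , b)))) ∘ toℕ)

X^[1+_]-1 : ℕ → Monic
X^[1+ n ]-1 = suc n , -1ℤ ∷ Vec.replicate n 0ℤ

-- Φ n is Xⁿ - 1 divided by Φ d for every divisor d < n of n, i.e. it is
-- determined by Xⁿ - 1 = ∏_{d ∣ n} Φ d.  The first argument of Φ′ only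
-- bounds the depth of the recursion; any bound ≥ n gives the same result.
-- Φ 0 is a dummy value.
Φ′ : ℕ → ℕ → Monic
Φ′ (suc b) (suc n) =
  List.foldr (λ d f → f ÷ Φ′ b d) (X^[1+ n ]-1) (properDivisors (suc n))
Φ′ _       _       = 0 , []

Φ : ℕ → Monic
Φ n = Φ′ n n

-- The basis of ⨁_{d ∣ k} ℤ[X]/(Φ d), where (d , r) stands for the class of
-- Xʳ in the summand ℤ[X]/(Φ d).

basis : ℕ → List (ℕ × ℕ)
basis k = concatMap (λ d → List.map (d ,_) (upTo (φ d))) (divisors k)

-- Gauss's identity ∑_{d ∣ k} φ(d) = k: the fractions 1/k, …, k/k in lowest
-- terms are the a/d with d ∣ k and a a totative of d.
private module Gauss (k : ℕ) where

  row : ℕ → List (ℕ × ℕ)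
  row d = List.map (d ,_) (totatives d)

  fractions : List (ℕ × ℕ)
  fractions = concatMap row (divisors k)

  length-concatMap : ∀ ds → length (concatMap (λ d → List.map (d ,_) (upTo (φ d))) ds)
                          ≡ length (concatMap row ds)
  length-concatMap []       = refl
  length-concatMap (d ∷ ds) = begin
    length (List.map (d ,_) (upTo (φ d)) ++ _)     ≡⟨ length-++ (List.map (d ,_) (upTo (φ d))) ⟩
    length (List.map (d ,_) (upTo (φ d))) ℕ.+ _    ≡⟨ cong₂ ℕ._+_ eq (length-concatMap ds) ⟩
    length (row d) ℕ.+ length (concatMap row ds)   ≡⟨ length-++ (row d) ⟨
    length (row d ++ concatMap row ds)             ∎
    where
    open ≡-Reasoning
    eq : length (List.map (d ,_) (upTo (φ d))) ≡ length (row d)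
    eq = trans (length-map (d ,_) (upTo (φ d)))
        (trans (length-upTo (φ d)) (sym (length-map (d ,_) (totatives d))))

  [1‥]-unique : ∀ n → Unique [1‥ n ]
  [1‥]-unique n = Unique.map⁺ ℕ.suc-injective (Unique.upTo⁺ n)

  ∈-[1‥]⁺ : ∀ {m n} .{{_ : ℕ.NonZero m}} → m ℕ.≤ n → m ∈ₗ [1‥ n ]
  ∈-[1‥]⁺ {suc _} m≤n = ∈-map⁺ suc (∈-upTo⁺ m≤n)

  ∈-[1‥]⁻ : ∀ {m n} → m ∈ₗ [1‥ n ] → ℕ.NonZero m × m ℕ.≤ n
  ∈-[1‥]⁻ m∈ with _ , i∈ , refl ← ∈-map⁻ suc m∈ = _ , ∈-upTo⁻ i∈

  fractions-unique : Unique fractions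
  fractions-unique = Unique.concat⁺
    (All.map⁺ (universal (λ d → Unique.map⁺ ,-injectiveʳ (Unique.filter⁺ (λ a → coprime? a d) ([1‥]-unique d))) (divisors k)))
    (AllPairs.map⁺ (AllPairs.map disjoint (Unique.filter⁺ (_∣? k) ([1‥]-unique k))))
    where
    ,-injectiveʳ : ∀ {d x y : ℕ} → (d , x) ≡ (d , y) → x ≡ y
    ,-injectiveʳ refl = refl
    disjoint : ∀ {d d′} → (d ≡ d′ → _) → ∀ {v} → v ∈ₗ row d × v ∈ₗ row d′ → _
    disjoint d≢d′ (v∈ , v∈′)
      with _ , _ , refl ← ∈-map⁻ _ v∈ | _ , _ , refl ← ∈-map⁻ _ v∈′ = d≢d′ refl

  reduce : ℕ → ℕ × ℕ
  reduce m = quotient (gcd[m,n]∣n m k) , quotient (gcd[m,n]∣m m k)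

  module _ .{{_ : ℕ.NonZero k}} where

    gcd-nonZero : ∀ m → ℕ.NonZero (gcd m k)
    gcd-nonZero m = ℕ.≢-nonZero λ g≡0 → ℕ.≢-nonZero⁻¹ k (gcd[m,n]≡0⇒n≡0 m g≡0)

    k≡ : ∀ m → k ≡ proj₁ (reduce m) ℕ.* gcd m k
    k≡ m = _∣_.equality (gcd[m,n]∣n m k)

    m≡ : ∀ m → m ≡ proj₂ (reduce m) ℕ.* gcd m k
    m≡ m = _∣_.equality (gcd[m,n]∣m m k)

    factor-nonZero : ∀ {n} .{{_ : ℕ.NonZero n}} q g → n ≡ q ℕ.* g → ℕ.NonZero q
    factor-nonZero {suc _} (suc q) g eq = _

    reduce-injective : ∀ {m m′} → reduce m ≡ reduce m′ → m ≡ m′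
    reduce-injective {m} {m′} eq = begin
      m                               ≡⟨ m≡ m ⟩
      proj₂ (reduce m)  ℕ.* gcd m k   ≡⟨ cong₂ ℕ._*_ (cong proj₂ eq) g≡g′ ⟩
      proj₂ (reduce m′) ℕ.* gcd m′ k  ≡⟨ m≡ m′ ⟨
      m′                              ∎
      where
      open ≡-Reasoning
      g≡g′ : gcd m k ≡ gcd m′ k
      g≡g′ = ℕ.*-cancelˡ-≡ _ _ (proj₁ (reduce m)) {{factor-nonZero _ (gcd m k) (k≡ m)}}
        (trans (sym (k≡ m)) (trans (k≡ m′) (cong (ℕ._* gcd m′ k) (cong proj₁ (sym eq)))))

    reduce-∈ : ∀ {m} → m ∈ₗ [1‥ k ] → reduce m ∈ₗ fractions
    reduce-∈ {m} m∈ = ∈-concatMap⁺ row (lose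
      (∈-filter⁺ (_∣? k) (∈-[1‥]⁺ {{d≢0}} (∣⇒≤ d∣k)) d∣k)
      (∈-map⁺ _ (∈-filter⁺ (λ a → coprime? a d) (∈-[1‥]⁺ {{a≢0}} a≤d) a⊥d)))
      where
      d = proj₁ (reduce m)
      a = proj₂ (reduce m)
      g = gcd m k
      d∣k : d ∣ k
      d∣k = divides g (trans (k≡ m) (ℕ.*-comm d g))
      d≢0 : ℕ.NonZero d
      d≢0 = factor-nonZero d g (k≡ m)
      a≢0 : ℕ.NonZero a
      a≢0 = factor-nonZero {{proj₁ (∈-[1‥]⁻ m∈)}} a g (m≡ m)
      a≤d : a ℕ.≤ d
      a≤d = ℕ.*-cancelʳ-≤ a d g {{gcd-nonZero m}}
        (ℕ.≤-trans (ℕ.≤-reflexive (sym (m≡ m))) (ℕ.≤-trans (proj₂ (∈-[1‥]⁻ m∈)) (ℕ.≤-reflexive (k≡ m))))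
      a⊥d : Coprime a d
      a⊥d = gcd≡1⇒coprime (ℕ.*-cancelˡ-≡ _ _ g {{gcd-nonZero m}} (begin
        g ℕ.* gcd a d            ≡⟨ c*gcd[m,n]≡gcd[cm,cn] g a d ⟩
        gcd (g ℕ.* a) (g ℕ.* d)  ≡⟨ cong₂ gcd (ℕ.*-comm g a) (ℕ.*-comm g d) ⟩
        gcd (a ℕ.* g) (d ℕ.* g)  ≡⟨ cong₂ gcd (m≡ m) (k≡ m) ⟨
        g                        ≡⟨ ℕ.*-identityʳ g ⟨
        g ℕ.* 1                  ∎))
        where open ≡-Reasoning

    ∈-reduce : ∀ {v} → v ∈ₗ fractions → v ∈ₗ List.map reduce [1‥ k ]
    ∈-reduce v∈
      with d , d∈ , v∈row ← find (∈-concatMap⁻ row {xs = divisors k} v∈)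
      with a , a∈ , refl ← ∈-map⁻ (d ,_) v∈row
      with a∈[1‥d] , a⊥d ← ∈-filter⁻ (λ a → coprime? a d) {xs = [1‥ d ]} a∈
      with _ , divides q k≡qd ← ∈-filter⁻ (_∣? k) {xs = [1‥ k ]} d∈
      = subst (_∈ₗ _) reduce-m≡ (∈-map⁺ reduce (∈-[1‥]⁺ {{m≢0}} m≤k))
      where
      open ≡-Reasoning
      m = q ℕ.* a
      q≢0 : ℕ.NonZero q
      q≢0 = factor-nonZero q d k≡qd
      m≢0 : ℕ.NonZero m
      m≢0 = ℕ.m*n≢0 q a {{q≢0}} {{proj₁ (∈-[1‥]⁻ a∈[1‥d])}}
      m≤k : m ℕ.≤ k
      m≤k = ℕ.≤-trans (ℕ.*-monoʳ-≤ q (proj₂ (∈-[1‥]⁻ a∈[1‥d]))) (ℕ.≤-reflexive (sym k≡qd))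
      g≡q : gcd m k ≡ q
      g≡q = begin
        gcd m k          ≡⟨ cong (gcd m) k≡qd ⟩
        gcd m (q ℕ.* d)  ≡⟨ c*gcd[m,n]≡gcd[cm,cn] q a d ⟨
        q ℕ.* gcd a d    ≡⟨ cong (q ℕ.*_) (coprime⇒gcd≡1 a⊥d) ⟩
        q ℕ.* 1          ≡⟨ ℕ.*-identityʳ q ⟩
        q                ∎
      cancel : ∀ x y n → n ≡ x ℕ.* gcd m k → n ≡ q ℕ.* y → x ≡ y
      cancel x y n n≡xg n≡qy = ℕ.*-cancelʳ-≡ x y q {{q≢0}} (begin
        x ℕ.* q        ≡⟨ cong (x ℕ.*_) g≡q ⟨
        x ℕ.* gcd m k  ≡⟨ n≡xg ⟨
        n              ≡⟨ n≡qy ⟩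
        q ℕ.* y        ≡⟨ ℕ.*-comm q y ⟩
        y ℕ.* q        ∎)
      reduce-m≡ : reduce m ≡ (d , a)
      reduce-m≡ = cong₂ _,_ (cancel _ d k (k≡ m) k≡qd) (cancel _ a m (m≡ m) refl)

    length-fractions : length fractions ≡ k
    length-fractions = begin
      length fractions                    ≡⟨ ↭-length (∼bag⇒↭ (unique∧set⇒bag fractions-unique
                                               (Unique.map⁺ reduce-injective ([1‥]-unique k))
                                               (mk⇔ ∈-reduce from))) ⟩
      length (List.map reduce [1‥ k ])    ≡⟨ length-map reduce [1‥ k ] ⟩
      length [1‥ k ]                      ≡⟨ length-map suc (upTo k) ⟩
      length (upTo k)                     ≡⟨ length-upTo k ⟩
      k                                   ∎
      where
      open ≡-Reasoning
      from : ∀ {v} → v ∈ₗ List.map reduce [1‥ k ] → v ∈ₗ fractions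
      from v∈ with m , m∈ , refl ← ∈-map⁻ reduce v∈ = reduce-∈ m∈

length-basis : ∀ k → length (basis k) ≡ k
length-basis zero      = refl
length-basis k@(suc _) = trans (Gauss.length-concatMap k (divisors k)) (Gauss.length-fractions k)

Matrix : ℕ → ℕ → Set
Matrix m n = Fin m → Fin n → ℤ

infix 4 _≈_
_≈_ : ∀ {m n} → Matrix m n → Matrix m n → Set
M ≈ N = ∀ i j → M i j ≡ N i j

infixl 7 _⊗_
_⊗_ : ∀ {l m n} → Matrix l m → Matrix m n → Matrix l n
(M ⊗ N) i j = sum +-0-commutativeMonoid (λ h → M i h ℤ.* N h j)

diag : ∀ {n} → (Fin n → ℤ) → Matrix n n
diag s i j with i Fin.≟ j
... | yes _ = s i
... | no  _ = 0ℤ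

𝟙 : ∀ {n} → Matrix n n
𝟙 = diag (λ _ → 1ℤ)

Invertible : ∀ {n} → Matrix n n → Set
Invertible U = ∃ λ V → U ⊗ V ≈ 𝟙 × V ⊗ U ≈ 𝟙

-- s lists the diagonal of a Smith normal form of M, with multiplicity.
IsElementaryDivisors : ∀ {n} → Matrix n n → Vec ℕ n → Set
IsElementaryDivisors M s =
  (∀ i j → i Fin.≤ j → lookup s i ∣ lookup s j) ×
  ∃ λ U → ∃ λ V → Invertible U × Invertible V ×
    U ⊗ M ⊗ V ≈ diag (λ i → + lookup s i)

multiplicity : ∀ {n} → ℕ → Vec ℕ n → ℕ
multiplicity a = Vec.count (ℕ._≟ a)

-- Column j holds the coordinates of the image of Xʲ under
-- ℤ[X]/(Xᵏ - 1) → ⨁_{d ∣ k} ℤ[X]/(Φ d).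
A : ∀ k → Matrix k k
A k i j =
  let d , r = List.lookup (basis k) (Fin.cast (sym (length-basis k)) i)
  in  coeff ((X^ toℕ j) mod Φ d) r

{-# OPTIONS --safe #-}

-- Existence.  Put n = pᵉ and m = (p - 1) n, so that pᵉ⁺¹ = m + n and
-- Φ (pᵉ⁺¹) = 1 + Xⁿ + … + X⁽ᵖ⁻¹⁾ⁿ has degree m.  On the basis consisting of
-- 1, X, …, Xᵐ⁻¹ and of the XᵃΦ (pᵉ⁺¹) with a < n, the summand ℤ[X]/(Φ (pᵉ⁺¹))
-- sees an identity block followed by zeros, while the summands with d ∣ n, in
-- which Xⁿ = 1, send XᵃΦ (pᵉ⁺¹) to p Xᵃ.  Hence A (pᵉ⁺¹) is equivalent to
-- 1 ⊕ p A (pᵉ) with an identity block of size m = φ (pᵉ⁺¹).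
--
-- Uniqueness.  Let diag t = U diag s V with divisibility chains s and t.  The i
-- equations (V x)ₕ = 0 with h < i have a primitive solution x supported on the
-- first i + 1 coordinates.  Then tₐ xₐ = (U diag s V x)ₐ is a multiple of sᵢ for
-- all a ≤ i, so sᵢ ∣ tᵢ; by symmetry s = t.
module Submission where

open import Defs
open import Data.Fin as Fin using (Fin; zero; suc; toℕ; _↑ˡ_; _↑ʳ_; splitAt; punchIn)
import Data.Fin.Properties as Fin
open import Data.Integer as ℤ using (ℤ; +_; 0ℤ; 1ℤ; -1ℤ)
import Data.Integer.Divisibility.Signed as ℤ∣
import Data.Integer.Properties as ℤ
open import Data.Integer.Solver using (module +-*-Solver)
open import Data.List as List using (List; []; _∷_; _++_; [_]; length; filter; upTo; concatMap)
import Data.List.Properties as List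
open import Data.List.Membership.Propositional using (find) renaming (_∈_ to _∈ₗ_)
open import Data.List.Membership.Propositional.Properties using (∈-map⁻; ∈-filter⁻; ∈-upTo⁻; ∈-concatMap⁻; ∈-lookup)
open import Data.List.Relation.Unary.Any using (here; there)
open import Data.Nat as ℕ using (ℕ; zero; suc; _^_; _∸_; _≤_; _>_; s≤s; z≤n)
import Data.Nat.Properties as ℕ
open import Data.Nat.Divisibility using (_∣_; _∣?_; _∣0; 1∣_; divides; ∣-refl; ∣-trans; ∣-antisym; ∣1⇒≡1; ∣⇒≤; n∣m*n; *-monoˡ-∣; *-monoʳ-∣; *-cancelʳ-∣)
open import Data.Nat.GCD using (gcd; gcd[m,n]∣m; gcd[m,n]∣n; gcd-greatest; gcd[m,n]≡0⇒m≡0; gcd[m,n]≡0⇒n≡0; c*gcd[m,n]≡gcd[cm,cn])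
open import Data.Nat.Primality using (Prime; euclidsLemma; prime⇒nonTrivial; ¬prime[0])
open import Data.Product using (_×_; ∃; _,_; proj₁; proj₂)
open import Data.Sum using (_⊎_; inj₁; inj₂; [_,_]′)
open import Data.Vec as Vec using (Vec; []; _∷_; lookup)
import Data.Vec.Properties as Vec
open import Data.Vec.Membership.Propositional using (_∈_)
open import Data.Vec.Membership.Propositional.Properties using (∈-++⁺ʳ; ∈-map⁺)
open import Data.Vec.Relation.Unary.Any using (here; there)
open import Function using (_∘_)
open import Function.Bundles using (_⇔_; mk⇔; Equivalence)
open import Relation.Binary.Bundles using (Setoid)
open import Relation.Binary.PropositionalEquality using (_≡_; _≢_; _≗_; refl; sym; trans; cong; cong₂; subst; module ≡-Reasoning)
import Relation.Binary.Reasoning.Setoid as SetoidReasoning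
open import Relation.Nullary using (¬_; yes; no; contradiction)
open import Relation.Unary using (Decidable)
open import Algebra.Properties.AbelianGroup ℤ.+-0-abelianGroup using () renaming (∙-cancelˡ to +ᶻ-cancelˡ; inverseʳ-unique to +ᶻ-inverseʳ-unique)
open import Algebra.Properties.Semiring.Sum ℤ.+-*-semiring using (sum; sum-remove; sum-cong-≗; sum-init-last; sum-replicate-zero; ∑-comm; *-distribˡ-sum; *-distribʳ-sum)

-- Matrices up to unimodular equivalence

-- The theorem speaks of every Smith diagonal, which is why uniqueness accompanies the construction
-- of one. In matrix terms the basis change is a Schur complement. With the rows for `d ∣ n` on top
-- and the first m columns on the left, `A (p ^ suc e)` is [[`P`, `Q`], [`𝟙`, `L`]]. Column a of `L`
-- holds the remainder of Xᵃ⁺ᵐ, so XᵃΦ has the coordinates `Q` - `P L` above and `L` - `L` = 0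
-- below. The columns split as m + n but the rows as n + m, so equivalence has to relate matrices
-- whose sizes agree only propositionally. `Φ` is defined by repeated division. Its closed form at
-- prime powers rests on two facts: division by a monic factor is exact, and Xᵖⁿ - 1 = (1 + Xⁿ + ...
-- + X⁽ᵖ⁻¹⁾ⁿ)(Xⁿ - 1), so that the successive quotients telescope. The value of `φ` comes from
-- Gauss's identity, by comparing the bases for n and pn. In the uniqueness proof, elimination
-- without fractions yields an integer solution that may have a common factor; dividing by the gcd
-- of its entries makes it primitive.

sum-zero : ∀ {n} {f : Fin n → ℤ} → (∀ i → f i ≡ 0ℤ) → sum f ≡ 0ℤ
sum-zero {n} f≗0 = trans (sum-cong-≗ f≗0) (sum-replicate-zero n)

sum-single : ∀ {n} {f : Fin n → ℤ} i → (∀ j → j ≢ i → f j ≡ 0ℤ) → sum f ≡ f i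
sum-single {suc n} {f} i f≡0 = begin
  sum f                         ≡⟨ sum-remove {i = i} f ⟩
  f i ℤ.+ sum (f ∘ punchIn i)   ≡⟨ cong (ℤ._+_ (f i)) (sum-zero (λ j → f≡0 _ (Fin.punchInᵢ≢i i j))) ⟩
  f i ℤ.+ 0ℤ                    ≡⟨ ℤ.+-identityʳ (f i) ⟩
  f i                           ∎
  where open ≡-Reasoning

sum-splitAt : ∀ m {n} (f : Fin (m ℕ.+ n) → ℤ) → sum f ≡ sum (f ∘ (_↑ˡ n)) ℤ.+ sum (f ∘ (m ↑ʳ_))
sum-splitAt zero    f = sym (ℤ.+-identityˡ _)
sum-splitAt (suc m) f = trans (cong (ℤ._+_ (f zero)) (sum-splitAt m (f ∘ suc))) (sym (ℤ.+-assoc (f zero) _ _))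

diag-≡ : ∀ {n} (s : Fin n → ℤ) i → diag s i i ≡ s i
diag-≡ s i with i Fin.≟ i
... | yes _  = refl
... | no i≢i = contradiction refl i≢i

diag-≢ : ∀ {n} (s : Fin n → ℤ) {i j} → i ≢ j → diag s i j ≡ 0ℤ
diag-≢ s {i} {j} i≢j with i Fin.≟ j
... | yes i≡j = contradiction i≡j i≢j
... | no _    = refl

diag-⊗ : ∀ {m n} (s : Fin m → ℤ) (M : Matrix m n) i j → (diag s ⊗ M) i j ≡ s i ℤ.* M i j
diag-⊗ s M i j = trans
  (sum-single i (λ h h≢i → trans (cong (ℤ._* M h j) (diag-≢ s (h≢i ∘ sym))) (ℤ.*-zeroˡ (M h j))))
  (cong (ℤ._* M i j) (diag-≡ s i))

⊗-diag : ∀ {m n} (M : Matrix m n) (s : Fin n → ℤ) i j → (M ⊗ diag s) i j ≡ M i j ℤ.* s j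
⊗-diag M s i j = trans
  (sum-single j (λ h h≢j → trans (cong (M i h ℤ.*_) (diag-≢ s h≢j)) (ℤ.*-zeroʳ (M i h))))
  (cong (M i j ℤ.*_) (diag-≡ s j))

⊗-identityˡ : ∀ {m n} (M : Matrix m n) → 𝟙 ⊗ M ≈ M
⊗-identityˡ M i j = trans (diag-⊗ _ M i j) (ℤ.*-identityˡ _)

⊗-identityʳ : ∀ {m n} (M : Matrix m n) → M ⊗ 𝟙 ≈ M
⊗-identityʳ M i j = trans (⊗-diag M _ i j) (ℤ.*-identityʳ _)

⊗-cong : ∀ {l m n} {M M′ : Matrix l m} {N N′ : Matrix m n} → M ≈ M′ → N ≈ N′ → M ⊗ N ≈ M′ ⊗ N′
⊗-cong M≈M′ N≈N′ i j = sum-cong-≗ λ h → cong₂ ℤ._*_ (M≈M′ i h) (N≈N′ h j)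

⊗-assoc : ∀ {k l m n} (L : Matrix k l) (M : Matrix l m) (N : Matrix m n) → L ⊗ M ⊗ N ≈ L ⊗ (M ⊗ N)
⊗-assoc L M N i j = begin
  sum (λ h → sum (λ g → L i g ℤ.* M g h) ℤ.* N h j)    ≡⟨ sum-cong-≗ (λ h → *-distribʳ-sum (N h j) (λ g → L i g ℤ.* M g h)) ⟩
  sum (λ h → sum (λ g → L i g ℤ.* M g h ℤ.* N h j))    ≡⟨ ∑-comm (λ h g → L i g ℤ.* M g h ℤ.* N h j) ⟩
  sum (λ g → sum (λ h → L i g ℤ.* M g h ℤ.* N h j))    ≡⟨ sum-cong-≗ (λ g → sum-cong-≗ (λ h → ℤ.*-assoc (L i g) (M g h) (N h j))) ⟩
  sum (λ g → sum (λ h → L i g ℤ.* (M g h ℤ.* N h j)))  ≡⟨ sum-cong-≗ (λ g → *-distribˡ-sum (L i g) (λ h → M g h ℤ.* N h j)) ⟨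
  sum (λ g → L i g ℤ.* sum (λ h → M g h ℤ.* N h j))    ∎
  where open ≡-Reasoning

≈-setoid : ℕ → ℕ → Setoid _ _
≈-setoid m n = record
  { Carrier       = Matrix m n
  ; _≈_           = _≈_
  ; isEquivalence = record
    { refl  = λ i j → refl
    ; sym   = λ M≈N i j → sym (M≈N i j)
    ; trans = λ L≈M M≈N i j → trans (L≈M i j) (M≈N i j)
    }
  }

module ≈-Reasoning {m n} = SetoidReasoning (≈-setoid m n)

⊗-congˡ : ∀ {l m n} (M : Matrix l m) {N N′ : Matrix m n} → N ≈ N′ → M ⊗ N ≈ M ⊗ N′
⊗-congˡ M N≈N′ = ⊗-cong {M = M} (λ _ _ → refl) N≈N′

⊗-congʳ : ∀ {l m n} {M M′ : Matrix l m} (N : Matrix m n) → M ≈ M′ → M ⊗ N ≈ M′ ⊗ N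
⊗-congʳ N M≈M′ = ⊗-cong {N = N} M≈M′ (λ _ _ → refl)

-- Square and rectangular at once, so that matrices whose sizes agree only
-- propositionally can be compared.
Unimodular : ∀ {m n} → Matrix m n → Set
Unimodular U = ∃ λ V → U ⊗ V ≈ 𝟙 × V ⊗ U ≈ 𝟙

Unimodular-⊗ : ∀ {l m n} {U : Matrix l m} {V : Matrix m n} → Unimodular U → Unimodular V → Unimodular (U ⊗ V)
Unimodular-⊗ {U = U} {V} (U⁻¹ , UU⁻¹≈𝟙 , U⁻¹U≈𝟙) (V⁻¹ , VV⁻¹≈𝟙 , V⁻¹V≈𝟙) =
  V⁻¹ ⊗ U⁻¹ , cancel U V V⁻¹ U⁻¹ VV⁻¹≈𝟙 UU⁻¹≈𝟙 , cancel V⁻¹ U⁻¹ U V U⁻¹U≈𝟙 V⁻¹V≈𝟙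
  where
  open ≈-Reasoning
  cancel : ∀ {a b c d} (W : Matrix a b) (X : Matrix b c) (Y : Matrix c b) (Z : Matrix b d) {E : Matrix a d} →
           X ⊗ Y ≈ 𝟙 → W ⊗ Z ≈ E → W ⊗ X ⊗ (Y ⊗ Z) ≈ E
  cancel W X Y Z {E} XY≈𝟙 WZ≈E = begin
    W ⊗ X ⊗ (Y ⊗ Z)    ≈⟨ ⊗-assoc W X (Y ⊗ Z) ⟩
    W ⊗ (X ⊗ (Y ⊗ Z))  ≈⟨ ⊗-congˡ W (⊗-assoc X Y Z) ⟨
    W ⊗ (X ⊗ Y ⊗ Z)    ≈⟨ ⊗-congˡ W (⊗-congʳ Z XY≈𝟙) ⟩
    W ⊗ (𝟙 ⊗ Z)        ≈⟨ ⊗-congˡ W (⊗-identityˡ Z) ⟩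
    W ⊗ Z              ≈⟨ WZ≈E ⟩
    E                  ∎

infix 4 _∼_
_∼_ : ∀ {a b c d} → Matrix a b → Matrix c d → Set
M ∼ N = ∃ λ U → ∃ λ V → Unimodular U × Unimodular V × U ⊗ M ⊗ V ≈ N

∼-trans : ∀ {a b c d e f} {L : Matrix a b} {M : Matrix c d} {N : Matrix e f} → L ∼ M → M ∼ N → L ∼ N
∼-trans {L = L} {M} {N} (U , V , uU , uV , UV≈M) (U′ , V′ , uU′ , uV′ , U′V′≈N) =
  U′ ⊗ U , V ⊗ V′ , Unimodular-⊗ uU′ uU , Unimodular-⊗ uV uV′ , (begin
    U′ ⊗ U ⊗ L ⊗ (V ⊗ V′)    ≈⟨ ⊗-congʳ (V ⊗ V′) (⊗-assoc U′ U L) ⟩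
    U′ ⊗ (U ⊗ L) ⊗ (V ⊗ V′)  ≈⟨ ⊗-assoc (U′ ⊗ (U ⊗ L)) V V′ ⟨
    U′ ⊗ (U ⊗ L) ⊗ V ⊗ V′    ≈⟨ ⊗-congʳ V′ (⊗-assoc U′ (U ⊗ L) V) ⟩
    U′ ⊗ (U ⊗ L ⊗ V) ⊗ V′    ≈⟨ ⊗-congʳ V′ (⊗-congˡ U′ UV≈M) ⟩
    U′ ⊗ M ⊗ V′              ≈⟨ U′V′≈N ⟩
    N                        ∎)
  where open ≈-Reasoning

∼-sym : ∀ {a b c d} {M : Matrix a b} {N : Matrix c d} → M ∼ N → N ∼ M
∼-sym {M = M} {N} (U , V , (U⁻¹ , UU⁻¹≈𝟙 , U⁻¹U≈𝟙) , (V⁻¹ , VV⁻¹≈𝟙 , V⁻¹V≈𝟙) , UMV≈N) =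
  U⁻¹ , V⁻¹ , (U , U⁻¹U≈𝟙 , UU⁻¹≈𝟙) , (V , V⁻¹V≈𝟙 , VV⁻¹≈𝟙) , (begin
    U⁻¹ ⊗ N ⊗ V⁻¹              ≈⟨ ⊗-congʳ V⁻¹ (⊗-congˡ U⁻¹ UMV≈N) ⟨
    U⁻¹ ⊗ (U ⊗ M ⊗ V) ⊗ V⁻¹    ≈⟨ ⊗-congʳ V⁻¹ (⊗-assoc U⁻¹ (U ⊗ M) V) ⟨
    U⁻¹ ⊗ (U ⊗ M) ⊗ V ⊗ V⁻¹    ≈⟨ ⊗-assoc (U⁻¹ ⊗ (U ⊗ M)) V V⁻¹ ⟩
    U⁻¹ ⊗ (U ⊗ M) ⊗ (V ⊗ V⁻¹)  ≈⟨ ⊗-congˡ (U⁻¹ ⊗ (U ⊗ M)) VV⁻¹≈𝟙 ⟩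
    U⁻¹ ⊗ (U ⊗ M) ⊗ 𝟙          ≈⟨ ⊗-identityʳ (U⁻¹ ⊗ (U ⊗ M)) ⟩
    U⁻¹ ⊗ (U ⊗ M)              ≈⟨ ⊗-assoc U⁻¹ U M ⟨
    U⁻¹ ⊗ U ⊗ M                ≈⟨ ⊗-congʳ M U⁻¹U≈𝟙 ⟩
    𝟙 ⊗ M                      ≈⟨ ⊗-identityˡ M ⟩
    M                          ∎)
  where open ≈-Reasoning

𝟙-unimodular : ∀ {n} → Unimodular (𝟙 {n})
𝟙-unimodular = 𝟙 , ⊗-identityˡ 𝟙 , ⊗-identityˡ 𝟙

∼-scale : ∀ {a b c d} {M : Matrix a b} {N : Matrix c d} → M ∼ N →
                      ∀ x → (λ i j → x ℤ.* M i j) ∼ (λ i j → x ℤ.* N i j)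
∼-scale {M = M} {N} (U , V , uU , uV , UV≈N) x = U , V , uU , uV , λ i j → (begin
    sum (λ h → sum (λ g → U i g ℤ.* (x ℤ.* M g h)) ℤ.* V h j)  ≡⟨ sum-cong-≗ (λ h → cong (ℤ._* V h j) (trans (sum-cong-≗ λ g → comm (U i g) (M g h)) (sym (*-distribˡ-sum x (λ g → U i g ℤ.* M g h))))) ⟩
    sum (λ h → x ℤ.* (U ⊗ M) i h ℤ.* V h j)                    ≡⟨ sum-cong-≗ (λ h → ℤ.*-assoc x _ (V h j)) ⟩
    sum (λ h → x ℤ.* ((U ⊗ M) i h ℤ.* V h j))                  ≡⟨ *-distribˡ-sum x (λ h → (U ⊗ M) i h ℤ.* V h j) ⟨
    x ℤ.* (U ⊗ M ⊗ V) i j                                      ≡⟨ cong (x ℤ.*_) (UV≈N i j) ⟩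
    x ℤ.* N i j                                                ∎)
  where
  open ≡-Reasoning
  comm : ∀ u m → u ℤ.* (x ℤ.* m) ≡ x ℤ.* (u ℤ.* m)
  comm u m = trans (sym (ℤ.*-assoc u x m)) (trans (cong (ℤ._* m) (ℤ.*-comm u x)) (ℤ.*-assoc x u m))

∼-respʳ-≈ : ∀ {a b c d} {M : Matrix a b} {N N′ : Matrix c d} → N ≈ N′ → M ∼ N → M ∼ N′
∼-respʳ-≈ N≈N′ (U , V , uU , uV , UV≈N) = U , V , uU , uV , λ i j → trans (UV≈N i j) (N≈N′ i j)

module _ {m n} (f : Fin n → Fin m) (g : Fin m → Fin n) (fg : ∀ i → f (g i) ≡ i) (gf : ∀ j → g (f j) ≡ j) where

  -- The permutation matrix of `f` is the transpose of that of its inverse `g`. This is what makes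
  -- it unimodular.
  𝟙-adjoint : ∀ i j → 𝟙 (f i) j ≡ 𝟙 i (g j)
  𝟙-adjoint i j with i Fin.≟ g j
  ... | yes refl = trans (cong (λ h → 𝟙 h j) (fg j)) (diag-≡ _ j)
  ... | no i≢gj  = diag-≢ _ λ fi≡j → i≢gj (trans (sym (gf i)) (cong g fi≡j))

  reindexing-unimodular : Unimodular (λ h j → 𝟙 h (f j))
  reindexing-unimodular = (λ i h → 𝟙 (f i) h) ,
    (λ i j → begin
      sum (λ h → 𝟙 i (f h) ℤ.* 𝟙 (f h) j)  ≡⟨ sum-cong-≗ (λ h → cong (𝟙 i (f h) ℤ.*_) (𝟙-adjoint h j)) ⟩
      sum (λ h → 𝟙 i (f h) ℤ.* 𝟙 h (g j))  ≡⟨ ⊗-identityʳ (λ i h → 𝟙 i (f h)) i (g j) ⟩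
      𝟙 i (f (g j))                        ≡⟨ cong (𝟙 i) (fg j) ⟩
      𝟙 i j                                ∎) ,
    (λ i j → begin
      sum (λ h → 𝟙 (f i) h ℤ.* 𝟙 h (f j))  ≡⟨ ⊗-identityʳ (λ i h → 𝟙 (f i) h) i (f j) ⟩
      𝟙 (f i) (f j)                        ≡⟨ 𝟙-adjoint i (f j) ⟩
      𝟙 i (g (f j))                        ≡⟨ cong (𝟙 i) (gf j) ⟩
      𝟙 i j                                ∎)
    where open ≡-Reasoning

  reindex-columns : ∀ {l} (M : Matrix l m) → M ∼ (λ i j → M i (f j))
  reindex-columns M = 𝟙 , (λ h j → 𝟙 h (f j)) , 𝟙-unimodular , reindexing-unimodular ,
    λ i j → trans (⊗-identityʳ (𝟙 ⊗ M) i (f j)) (⊗-identityˡ M i (f j))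

-- Block matrices

𝟘 : ∀ {m n} → Matrix m n
𝟘 i j = 0ℤ

infixl 6 _⊞_
_⊞_ : ∀ {m n} → Matrix m n → Matrix m n → Matrix m n
(M ⊞ N) i j = M i j ℤ.+ N i j

infix 8 ⊟_
⊟_ : ∀ {m n} → Matrix m n → Matrix m n
(⊟ M) i j = ℤ.- M i j

⊞-cong : ∀ {m n} {M M′ N N′ : Matrix m n} → M ≈ M′ → N ≈ N′ → M ⊞ N ≈ M′ ⊞ N′
⊞-cong M≈M′ N≈N′ i j = cong₂ ℤ._+_ (M≈M′ i j) (N≈N′ i j)

𝟘-⊗ : ∀ {l m n} (M : Matrix m n) → 𝟘 {l} ⊗ M ≈ 𝟘
𝟘-⊗ M i j = sum-zero λ h → ℤ.*-zeroˡ (M h j)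

⊗-𝟘 : ∀ {l m n} (M : Matrix l m) → M ⊗ 𝟘 {m} {n} ≈ 𝟘
⊗-𝟘 M i j = sum-zero λ h → ℤ.*-zeroʳ (M i h)

-- Indexing by sums lets a block be selected by pattern matching, once `splitAt` has been applied to
-- the indices.
entry : ∀ {a b c d} → Matrix a c → Matrix a d → Matrix b c → Matrix b d → Fin a ⊎ Fin b → Fin c ⊎ Fin d → ℤ
entry P Q R S (inj₁ i) (inj₁ j) = P i j
entry P Q R S (inj₁ i) (inj₂ j) = Q i j
entry P Q R S (inj₂ i) (inj₁ j) = R i j
entry P Q R S (inj₂ i) (inj₂ j) = S i j

block : ∀ {a b c d} → Matrix a c → Matrix a d → Matrix b c → Matrix b d → Matrix (a ℕ.+ b) (c ℕ.+ d)
block {a} {c = c} P Q R S i j = entry P Q R S (splitAt a i) (splitAt c j)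

block-cong : ∀ {a b c d} {P P′ : Matrix a c} {Q Q′ : Matrix a d} {R R′ : Matrix b c} {S S′ : Matrix b d} →
             P ≈ P′ → Q ≈ Q′ → R ≈ R′ → S ≈ S′ → block P Q R S ≈ block P′ Q′ R′ S′
block-cong {a} {c = c} p q r s i j with splitAt a i | splitAt c j
... | inj₁ i | inj₁ j = p i j
... | inj₁ i | inj₂ j = q i j
... | inj₂ i | inj₁ j = r i j
... | inj₂ i | inj₂ j = s i j

block-⊗ : ∀ {a b c d e f} (P : Matrix a c) (Q : Matrix a d) (R : Matrix b c) (S : Matrix b d)
          (P′ : Matrix c e) (Q′ : Matrix c f) (R′ : Matrix d e) (S′ : Matrix d f) →
          block P Q R S ⊗ block P′ Q′ R′ S′ ≈
          block (P ⊗ P′ ⊞ Q ⊗ R′) (P ⊗ Q′ ⊞ Q ⊗ S′) (R ⊗ P′ ⊞ S ⊗ R′) (R ⊗ Q′ ⊞ S ⊗ S′)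
block-⊗ {a} {c = c} {d} {e} P Q R S P′ Q′ R′ S′ i j = trans (sum-splitAt c _) (trans
  (cong₂ ℤ._+_
    (sum-cong-≗ λ h → cong (λ x → entry P Q R S (splitAt a i) x ℤ.* entry P′ Q′ R′ S′ x (splitAt e j)) (Fin.splitAt-↑ˡ c h d))
    (sum-cong-≗ λ h → cong (λ x → entry P Q R S (splitAt a i) x ℤ.* entry P′ Q′ R′ S′ x (splitAt e j)) (Fin.splitAt-↑ʳ c d h)))
  (cases (splitAt a i) (splitAt e j)))
  where
  cases : ∀ x y → sum (λ h → entry P Q R S x (inj₁ h) ℤ.* entry P′ Q′ R′ S′ (inj₁ h) y) ℤ.+
                  sum (λ h → entry P Q R S x (inj₂ h) ℤ.* entry P′ Q′ R′ S′ (inj₂ h) y)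
                ≡ entry (P ⊗ P′ ⊞ Q ⊗ R′) (P ⊗ Q′ ⊞ Q ⊗ S′) (R ⊗ P′ ⊞ S ⊗ R′) (R ⊗ Q′ ⊞ S ⊗ S′) x y
  cases (inj₁ i) (inj₁ j) = refl
  cases (inj₁ i) (inj₂ j) = refl
  cases (inj₂ i) (inj₁ j) = refl
  cases (inj₂ i) (inj₂ j) = refl

block-diag : ∀ {m n} (s : Fin m → ℤ) (t : Fin n → ℤ) → block (diag s) 𝟘 𝟘 (diag t) ≈ diag ([ s , t ]′ ∘ splitAt m)
block-diag {m} {n} s t i j with i Fin.≟ j
... | yes refl with splitAt m i
...   | inj₁ i′ = diag-≡ s i′
...   | inj₂ i′ = diag-≡ t i′
block-diag {m} {n} s t i j | no i≢j with splitAt m i in eqi | splitAt m j in eqj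
...   | inj₁ i′ | inj₁ j′ = diag-≢ s {i′} {j′} λ { refl → i≢j (trans (sym (Fin.splitAt⁻¹-↑ˡ eqi)) (Fin.splitAt⁻¹-↑ˡ eqj)) }
...   | inj₁ i′ | inj₂ j′ = refl
...   | inj₂ i′ | inj₁ j′ = refl
...   | inj₂ i′ | inj₂ j′ = diag-≢ t {i′} {j′} λ { refl → i≢j (trans (sym (Fin.splitAt⁻¹-↑ʳ eqi)) (Fin.splitAt⁻¹-↑ʳ eqj)) }

block-𝟙 : ∀ {m n} {P : Matrix m m} {Q : Matrix m n} {R : Matrix n m} {S : Matrix n n} →
          P ≈ 𝟙 → Q ≈ 𝟘 → R ≈ 𝟘 → S ≈ 𝟙 → block P Q R S ≈ 𝟙
block-𝟙 {m} {n} p q r s i j = trans (block-cong {S′ = 𝟙} p q r s i j) (trans (block-diag {m} {n} (λ _ → 1ℤ) (λ _ → 1ℤ) i j) (diag-1 i j))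
  where
  const-1 : (x : Fin m ⊎ Fin n) → [ (λ _ → 1ℤ) , (λ _ → 1ℤ) ]′ x ≡ 1ℤ
  const-1 (inj₁ _) = refl
  const-1 (inj₂ _) = refl
  diag-1 : diag ([ (λ _ → 1ℤ) , (λ _ → 1ℤ) ]′ ∘ splitAt m {n}) ≈ 𝟙
  diag-1 i j with i Fin.≟ j
  ... | yes _ = const-1 (splitAt m i)
  ... | no  _ = refl

⊞-identityˡ : ∀ {m n} {M N O : Matrix m n} → M ≈ 𝟘 → N ≈ O → M ⊞ N ≈ O
⊞-identityˡ M≈𝟘 N≈O i j = trans (cong₂ ℤ._+_ (M≈𝟘 i j) (N≈O i j)) (ℤ.+-identityˡ _)

⊞-identityʳ : ∀ {m n} {M N O : Matrix m n} → M ≈ O → N ≈ 𝟘 → M ⊞ N ≈ O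
⊞-identityʳ M≈O N≈𝟘 i j = trans (cong₂ ℤ._+_ (M≈O i j) (N≈𝟘 i j)) (ℤ.+-identityʳ _)

⊞-inverseˡ : ∀ {m n} {M N O : Matrix m n} → M ≈ ⊟ O → N ≈ O → M ⊞ N ≈ 𝟘
⊞-inverseˡ {O = O} M≈⊟O N≈O i j = trans (cong₂ ℤ._+_ (M≈⊟O i j) (N≈O i j)) (ℤ.+-inverseˡ (O i j))

⊞-inverseʳ : ∀ {m n} {M N O : Matrix m n} → M ≈ O → N ≈ ⊟ O → M ⊞ N ≈ 𝟘
⊞-inverseʳ {O = O} M≈O N≈⊟O i j = trans (cong₂ ℤ._+_ (M≈O i j) (N≈⊟O i j)) (ℤ.+-inverseʳ (O i j))

block-unimodular : ∀ {l m n} {U : Matrix m n} → Unimodular U → Unimodular (block (𝟙 {l}) 𝟘 𝟘 U)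
block-unimodular {U = U} (V , UV≈𝟙 , VU≈𝟙) = block 𝟙 𝟘 𝟘 V , inverse U V UV≈𝟙 , inverse V U VU≈𝟙
  where
  inverse : ∀ {l m n} (U : Matrix m n) (V : Matrix n m) → U ⊗ V ≈ 𝟙 → block (𝟙 {l}) 𝟘 𝟘 U ⊗ block 𝟙 𝟘 𝟘 V ≈ 𝟙
  inverse {l} {m} {n} U V UV≈𝟙 i j = trans (block-⊗ 𝟙 𝟘 𝟘 U 𝟙 𝟘 𝟘 V i j) (block-𝟙
    (⊞-identityʳ (⊗-identityˡ 𝟙) (𝟘-⊗ {m = n} 𝟘))
    (⊞-identityˡ (⊗-𝟘 𝟙) (𝟘-⊗ V))
    (⊞-identityˡ (𝟘-⊗ 𝟙) (⊗-𝟘 U))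
    (⊞-identityˡ (𝟘-⊗ {m = l} 𝟘) UV≈𝟙) i j)

block-∼ : ∀ {l a b c d} {M : Matrix a b} {N : Matrix c d} → M ∼ N → block (𝟙 {l}) 𝟘 𝟘 M ∼ block (𝟙 {l}) 𝟘 𝟘 N
block-∼ {M = M} {N} (U , V , uU , uV , UMV≈N) = block 𝟙 𝟘 𝟘 U , block 𝟙 𝟘 𝟘 V , block-unimodular uU , block-unimodular uV , (begin
  block 𝟙 𝟘 𝟘 U ⊗ block 𝟙 𝟘 𝟘 M ⊗ block 𝟙 𝟘 𝟘 V  ≈⟨ ⊗-congʳ (block 𝟙 𝟘 𝟘 V) (mult U M) ⟩
  block 𝟙 𝟘 𝟘 (U ⊗ M) ⊗ block 𝟙 𝟘 𝟘 V            ≈⟨ mult (U ⊗ M) V ⟩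
  block 𝟙 𝟘 𝟘 (U ⊗ M ⊗ V)                        ≈⟨ block-cong (λ _ _ → refl) (λ _ _ → refl) (λ _ _ → refl) UMV≈N ⟩
  block 𝟙 𝟘 𝟘 N                                  ∎)
  where
  open ≈-Reasoning
  mult : ∀ {l a n c} (U : Matrix a n) (V : Matrix n c) → block (𝟙 {l}) 𝟘 𝟘 U ⊗ block 𝟙 𝟘 𝟘 V ≈ block 𝟙 𝟘 𝟘 (U ⊗ V)
  mult {l} {n = n} U V i j = trans (block-⊗ 𝟙 𝟘 𝟘 U 𝟙 𝟘 𝟘 V i j) (block-cong
    (⊞-identityʳ (⊗-identityˡ 𝟙) (𝟘-⊗ {m = n} 𝟘))
    (⊞-identityˡ (⊗-𝟘 𝟙) (𝟘-⊗ V))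
    (⊞-identityˡ (𝟘-⊗ 𝟙) (⊗-𝟘 U))
    (⊞-identityˡ {N = U ⊗ V} (𝟘-⊗ {m = l} 𝟘) (λ _ _ → refl)) i j)

-- [[0, 1], [1, -P]] [[P, Q], [1, L]] [[1, -L], [0, 1]] = [[1, 0], [0, Q - P L]].
pivot : ∀ {m n} (P : Matrix n m) (Q : Matrix n n) (L : Matrix m n) → block P Q 𝟙 L ∼ block 𝟙 𝟘 𝟘 (Q ⊞ ⊟ P ⊗ L)
pivot P Q L = block 𝟘 𝟙 𝟙 (⊟ P) , block 𝟙 (⊟ L) 𝟘 𝟙 , uU , uV , (begin
  block 𝟘 𝟙 𝟙 (⊟ P) ⊗ block P Q 𝟙 L ⊗ block 𝟙 (⊟ L) 𝟘 𝟙  ≈⟨ ⊗-congʳ (block 𝟙 (⊟ L) 𝟘 𝟙) (λ i j → trans (block-⊗ 𝟘 𝟙 𝟙 (⊟ P) P Q 𝟙 L i j) (block-cong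
      (⊞-identityˡ (𝟘-⊗ P) (⊗-identityˡ 𝟙))
      (⊞-identityˡ (𝟘-⊗ Q) (⊗-identityˡ L))
      (⊞-inverseʳ (⊗-identityˡ P) (⊗-identityʳ (⊟ P)))
      (⊞-cong {N = ⊟ P ⊗ L} (⊗-identityˡ Q) (λ _ _ → refl)) i j)) ⟩
  block 𝟙 L 𝟘 (Q ⊞ ⊟ P ⊗ L) ⊗ block 𝟙 (⊟ L) 𝟘 𝟙  ≈⟨ (λ i j → trans (block-⊗ 𝟙 L 𝟘 (Q ⊞ ⊟ P ⊗ L) 𝟙 (⊟ L) 𝟘 𝟙 i j) (block-cong
      (⊞-identityʳ (⊗-identityˡ 𝟙) (⊗-𝟘 L))
      (⊞-inverseˡ (⊗-identityˡ (⊟ L)) (⊗-identityʳ L))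
      (⊞-identityˡ (𝟘-⊗ 𝟙) (⊗-𝟘 (Q ⊞ ⊟ P ⊗ L)))
      (⊞-identityˡ (𝟘-⊗ (⊟ L)) (⊗-identityʳ (Q ⊞ ⊟ P ⊗ L))) i j)) ⟩
  block 𝟙 𝟘 𝟘 (Q ⊞ ⊟ P ⊗ L) ∎)
  where
  open ≈-Reasoning
  uU : Unimodular (block 𝟘 𝟙 𝟙 (⊟ P))
  uU = block P 𝟙 𝟙 𝟘 ,
    (λ i j → trans (block-⊗ 𝟘 𝟙 𝟙 (⊟ P) P 𝟙 𝟙 𝟘 i j) (block-𝟙
      (⊞-identityˡ (𝟘-⊗ P) (⊗-identityˡ 𝟙))
      (⊞-identityˡ (𝟘-⊗ 𝟙) (⊗-𝟘 𝟙))
      (⊞-inverseʳ (⊗-identityˡ P) (⊗-identityʳ (⊟ P)))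
      (⊞-identityʳ (⊗-identityˡ 𝟙) (⊗-𝟘 (⊟ P))) i j)) ,
    (λ i j → trans (block-⊗ P 𝟙 𝟙 𝟘 𝟘 𝟙 𝟙 (⊟ P) i j) (block-𝟙
      (⊞-identityˡ (⊗-𝟘 P) (⊗-identityˡ 𝟙))
      (⊞-inverseʳ (⊗-identityʳ P) (⊗-identityˡ (⊟ P)))
      (⊞-identityˡ (⊗-𝟘 𝟙) (𝟘-⊗ 𝟙))
      (⊞-identityʳ (⊗-identityˡ 𝟙) (𝟘-⊗ (⊟ P))) i j))
  uV : Unimodular (block 𝟙 (⊟ L) 𝟘 𝟙)
  uV = block 𝟙 L 𝟘 𝟙 ,
    (λ i j → trans (block-⊗ 𝟙 (⊟ L) 𝟘 𝟙 𝟙 L 𝟘 𝟙 i j) (block-𝟙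
      (⊞-identityʳ (⊗-identityˡ 𝟙) (⊗-𝟘 (⊟ L)))
      (⊞-inverseʳ (⊗-identityˡ L) (⊗-identityʳ (⊟ L)))
      (⊞-identityˡ (𝟘-⊗ 𝟙) (⊗-𝟘 𝟙))
      (⊞-identityˡ (𝟘-⊗ L) (⊗-identityˡ 𝟙)) i j)) ,
    (λ i j → trans (block-⊗ 𝟙 L 𝟘 𝟙 𝟙 (⊟ L) 𝟘 𝟙 i j) (block-𝟙
      (⊞-identityʳ (⊗-identityˡ 𝟙) (⊗-𝟘 L))
      (⊞-inverseˡ (⊗-identityˡ (⊟ L)) (⊗-identityʳ L))
      (⊞-identityˡ (𝟘-⊗ 𝟙) (⊗-𝟘 𝟙))
      (⊞-identityˡ (𝟘-⊗ (⊟ L)) (⊗-identityˡ 𝟙)) i j))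

-- Uniqueness of the elementary divisors

infixr 7 _⊙_
_⊙_ : ∀ {m n} → Matrix m n → (Fin n → ℤ) → Fin m → ℤ
(M ⊙ x) i = sum λ h → M i h ℤ.* x h

-- A vector is a matrix with one column, whose only column index is `zero {n = 0}`.
⊙-assoc : ∀ {l m n} (M : Matrix l m) (N : Matrix m n) x i → (M ⊙ N ⊙ x) i ≡ ((M ⊗ N) ⊙ x) i
⊙-assoc M N x i = sym (⊗-assoc M N (λ h _ → x h) i (zero {n = 0}))

diag-⊙ : ∀ {n} (s x : Fin n → ℤ) i → (diag s ⊙ x) i ≡ s i ℤ.* x i
diag-⊙ s x i = diag-⊗ s (λ h _ → x h) i (zero {n = 0})

Nonzero : ∀ {n} → (Fin n → ℤ) → Set
Nonzero x = ∃ λ j → x j ≢ 0ℤ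

-- The columns of `N` are independent solutions of one equation. If a₀ ≠ 0, column j is a₀ eⱼ₊₁ -
-- aⱼ₊₁ e₀, which avoids division; if a₀ = 0, the vector e₀ is itself a solution and the remaining
-- columns come from the tail of `a`. Over ℤ these columns may span a proper subgroup of the
-- solutions, so only injectivity of `N` is claimed.
annihilator : ∀ n (a : Fin (suc n) → ℤ) → ∃ λ (N : Matrix (suc n) n) →
              (∀ j → sum (λ h → a h ℤ.* N h j) ≡ 0ℤ) × (∀ y → Nonzero y → Nonzero (N ⊙ y))
annihilator n a with a zero ℤ.≟ 0ℤ
annihilator zero a | yes a₀≡0 = (λ _ ()) , (λ ()) , λ _ ()
annihilator (suc n) a | yes a₀≡0 with N , aN≡0 , N-injective ← annihilator n (a ∘ suc) = N⁺ , aN⁺≡0 , N⁺-injective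
  where
  N⁺ : Matrix (suc (suc n)) (suc n)
  N⁺ zero    zero    = 1ℤ
  N⁺ zero    (suc j) = 0ℤ
  N⁺ (suc i) zero    = 0ℤ
  N⁺ (suc i) (suc j) = N i j
  aN⁺≡0 : ∀ j → sum (λ h → a h ℤ.* N⁺ h j) ≡ 0ℤ
  aN⁺≡0 zero    = cong₂ ℤ._+_ (cong (ℤ._* 1ℤ) a₀≡0) (sum-zero (λ h → ℤ.*-zeroʳ (a (suc h))))
  aN⁺≡0 (suc j) = cong₂ ℤ._+_ (ℤ.*-zeroʳ (a zero)) (aN≡0 j)
  N⁺-injective : ∀ y → Nonzero y → Nonzero (N⁺ ⊙ y)
  N⁺-injective y (zero , y₀≢0) = zero , λ eq → y₀≢0 (begin
    y zero               ≡⟨ ℤ.*-identityˡ (y zero) ⟨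
    1ℤ ℤ.* y zero        ≡⟨ ℤ.+-identityʳ (1ℤ ℤ.* y zero) ⟨
    1ℤ ℤ.* y zero ℤ.+ 0ℤ ≡⟨ cong (ℤ._+_ (1ℤ ℤ.* y zero)) (sum-zero (λ j → ℤ.*-zeroˡ (y (suc j)))) ⟨
    (N⁺ ⊙ y) zero        ≡⟨ eq ⟩
    0ℤ                   ∎)
    where open ≡-Reasoning
  N⁺-injective y (suc j , yⱼ≢0) with i , Nyᵢ≢0 ← N-injective (y ∘ suc) (j , yⱼ≢0) = suc i , λ eq →
    Nyᵢ≢0 (trans (sym (ℤ.+-identityˡ _)) (trans (cong (ℤ._+ (N ⊙ y ∘ suc) i) (sym (ℤ.*-zeroˡ (y zero)))) eq))
annihilator n a | no a₀≢0 = N , aN≡0 , N-injective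
  where
  N : Matrix (suc n) n
  N zero    j = ℤ.- a (suc j)
  N (suc i) j = diag (λ _ → a zero) i j
  aN≡0 : ∀ j → sum (λ h → a h ℤ.* N h j) ≡ 0ℤ
  aN≡0 j = trans (cong (ℤ._+_ (a zero ℤ.* N zero j)) (⊗-diag {suc n} (λ _ → a ∘ suc) (λ _ → a zero) zero j))
    (solve 2 (λ x y → x :* (:- y) :+ y :* x := con 0ℤ) refl (a zero) (a (suc j)))
    where open +-*-Solver
  N-injective : ∀ y → Nonzero y → Nonzero (N ⊙ y)
  N-injective y (j , yⱼ≢0) = suc j , λ eq →
    [ a₀≢0 , yⱼ≢0 ]′ (ℤ.i*j≡0⇒i≡0∨j≡0 (a zero) (trans (sym (diag-⊙ (λ _ → a zero) y j)) eq))

-- Gaussian elimination: the substitution x = `N ⊙ y` solves the first equation and leaves one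
-- equation and one unknown fewer. Injectivity of `N` keeps the solution nonzero.
kernel : ∀ n (Q : Matrix n (suc n)) → ∃ λ x → Nonzero x × (∀ i → (Q ⊙ x) i ≡ 0ℤ)
kernel zero    Q = (λ _ → 1ℤ) , (zero , λ ()) , λ ()
kernel (suc n) Q
  with N , aN≡0 , N-injective ← annihilator (suc n) (Q zero)
  with y , y≢0 , Q′y≡0 ← kernel n ((Q ∘ suc) ⊗ N)
  = N ⊙ y , N-injective y y≢0 , λ
    { zero    → trans (⊙-assoc Q N y zero) (sum-zero λ j → trans (cong (ℤ._* y j) (aN≡0 j)) (ℤ.*-zeroˡ (y j)))
    ; (suc i) → trans (⊙-assoc (Q ∘ suc) N y i) (Q′y≡0 i)
    }

content : ∀ {n} → (Fin n → ℤ) → ℕ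
content {zero}  x = 0
content {suc n} x = gcd ℤ.∣ x zero ∣ (content (x ∘ suc))

content-∣ : ∀ {n} (x : Fin n → ℤ) j → content x ∣ ℤ.∣ x j ∣
content-∣ x zero    = gcd[m,n]∣m ℤ.∣ x zero ∣ _
content-∣ x (suc j) = ∣-trans (gcd[m,n]∣n ℤ.∣ x zero ∣ _) (content-∣ (x ∘ suc) j)

-- The factor `t` is carried along because gcds commute with multiplication by `t`; primitivity is
-- extracted from this form.
content-greatest : ∀ {n} (x : Fin n → ℤ) m t → (∀ j → m ∣ t ℕ.* ℤ.∣ x j ∣) → m ∣ t ℕ.* content x
content-greatest {zero}  x m t m∣tx = subst (m ∣_) (sym (ℕ.*-zeroʳ t)) (m ∣0)
content-greatest {suc n} x m t m∣tx = subst (m ∣_) (sym (c*gcd[m,n]≡gcd[cm,cn] t ℤ.∣ x zero ∣ _))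
  (gcd-greatest (m∣tx zero) (content-greatest (x ∘ suc) m t (m∣tx ∘ suc)))

content≡0 : ∀ {n} (x : Fin n → ℤ) → content x ≡ 0 → ∀ j → x j ≡ 0ℤ
content≡0 x eq zero    = ℤ.∣i∣≡0⇒i≡0 (gcd[m,n]≡0⇒m≡0 eq)
content≡0 x eq (suc j) = content≡0 (x ∘ suc) (gcd[m,n]≡0⇒n≡0 ℤ.∣ x zero ∣ eq) j

-- The entries have gcd 1, expressed as the cancellation property through which sᵢ ∣ tᵢ is finally
-- obtained.
Primitive : ∀ {n} → (Fin n → ℤ) → Set
Primitive x = ∀ m t → (∀ j → m ∣ t ℕ.* ℤ.∣ x j ∣) → m ∣ t

primitiveKernel : ∀ n (Q : Matrix n (suc n)) → ∃ λ x → Primitive x × (∀ i → (Q ⊙ x) i ≡ 0ℤ)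
primitiveKernel n Q with x , (j₀ , xⱼ≢0) , Qx≡0 ← kernel n Q = x′ , x′-primitive , Qx′≡0
  where
  open ≡-Reasoning
  g = content x
  instance
    g≢0 : ℕ.NonZero g
    g≢0 = ℕ.≢-nonZero λ g≡0 → xⱼ≢0 (content≡0 x g≡0 j₀)
  g∣x : ∀ j → + g ℤ∣.∣ x j
  g∣x j = ℤ∣.∣ᵤ⇒∣ (content-∣ x j)
  x′ : Fin (suc n) → ℤ
  x′ j = ℤ∣._∣_.quotient (g∣x j)
  x≡x′g : ∀ j → x j ≡ x′ j ℤ.* + g
  x≡x′g j = ℤ∣._∣_.equality (g∣x j)
  x′-primitive : Primitive x′
  -- From m ∣ t x′ⱼ follows m g ∣ t xⱼ for all j, hence m g ∣ t g, and g cancels.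
  x′-primitive m t m∣tx′ = *-cancelʳ-∣ g (content-greatest x (m ℕ.* g) t λ j → subst (m ℕ.* g ∣_) (begin
    t ℕ.* ℤ.∣ x′ j ∣ ℕ.* g    ≡⟨ ℕ.*-assoc t _ g ⟩
    t ℕ.* (ℤ.∣ x′ j ∣ ℕ.* g)  ≡⟨ cong (t ℕ.*_) (ℤ.abs-* (x′ j) (+ g)) ⟨
    t ℕ.* ℤ.∣ x′ j ℤ.* + g ∣  ≡⟨ cong (λ y → t ℕ.* ℤ.∣ y ∣) (x≡x′g j) ⟨
    t ℕ.* ℤ.∣ x j ∣           ∎) (*-monoˡ-∣ g (m∣tx′ j)))
  Qx′≡0 : ∀ i → (Q ⊙ x′) i ≡ 0ℤ
  Qx′≡0 i = ℤ.*-cancelʳ-≡ _ 0ℤ (+ g) (begin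
    (Q ⊙ x′) i ℤ.* + g                    ≡⟨ *-distribʳ-sum (+ g) (λ h → Q i h ℤ.* x′ h) ⟩
    sum (λ h → Q i h ℤ.* x′ h ℤ.* + g)    ≡⟨ sum-cong-≗ (λ h → trans (ℤ.*-assoc (Q i h) (x′ h) (+ g)) (cong (Q i h ℤ.*_) (sym (x≡x′g h)))) ⟩
    (Q ⊙ x) i                             ≡⟨ Qx≡0 i ⟩
    0ℤ                                    ∎)

∣-sum : ∀ {n} {d : ℤ} {f : Fin n → ℤ} → (∀ i → d ℤ∣.∣ f i) → d ℤ∣.∣ sum f
∣-sum {zero}  {d} d∣f = ℤ∣.∣ᵤ⇒∣ (_ ∣0)
∣-sum {suc n} d∣f = ℤ∣.∣m∣n⇒∣m+n (d∣f zero) (∣-sum (d∣f ∘ suc))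

module _ {n} (V : Matrix (suc n) (suc n)) (i : Fin (suc n)) where

  -- The rows below row i are unit rows, which turn the support condition xₕ = 0 for h > i into
  -- further linear equations. Row i itself is to be deleted.
  firstRows : Matrix (suc n) (suc n)
  firstRows h with h Fin.<? i
  ... | yes _ = V h
  ... | no  _ = 𝟙 h

  firstRows-< : ∀ {h} → h Fin.< i → firstRows h ≡ V h
  firstRows-< {h} h<i with h Fin.<? i
  ... | yes _  = refl
  ... | no h≮i = contradiction h<i h≮i

  firstRows-≮ : ∀ {h} → ¬ (h Fin.< i) → firstRows h ≡ 𝟙 h
  firstRows-≮ {h} h≮i with h Fin.<? i
  ... | yes h<i = contradiction h<i h≮i
  ... | no  _   = refl

-- Deleting row i of `firstRows` by `punchIn i` leaves one equation fewer than unknowns, so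
-- `primitiveKernel` applies to the equations of both kinds at once.
supportedKernel : ∀ {n} (V : Matrix n n) (i : Fin n) → ∃ λ x → Primitive x ×
                  (∀ h → h Fin.< i → (V ⊙ x) h ≡ 0ℤ) × (∀ h → i Fin.< h → x h ≡ 0ℤ)
supportedKernel {suc n} V i = from (primitiveKernel n (firstRows V i ∘ punchIn i))
  where
  open ≡-Reasoning
  from : (∃ λ x → Primitive x × ∀ j → ((firstRows V i ∘ punchIn i) ⊙ x) j ≡ 0ℤ) → _
  from (x , x-primitive , Wx≡0) = x , x-primitive ,
    (λ h h<i → begin
      (V ⊙ x) h              ≡⟨ sum-cong-≗ (λ j → cong (λ r → r j ℤ.* x j) (firstRows-< V i h<i)) ⟨
      (firstRows V i ⊙ x) h  ≡⟨ zero-row (Fin.<⇒≢ h<i ∘ sym) ⟩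
      0ℤ                     ∎) ,
    (λ h i<h → begin
      x h                    ≡⟨ ℤ.*-identityˡ (x h) ⟨
      1ℤ ℤ.* x h             ≡⟨ diag-⊙ (λ _ → 1ℤ) x h ⟨
      (𝟙 ⊙ x) h              ≡⟨ sum-cong-≗ (λ j → cong (λ r → r j ℤ.* x j) (firstRows-≮ V i (ℕ.<-asym i<h))) ⟨
      (firstRows V i ⊙ x) h  ≡⟨ zero-row (Fin.<⇒≢ i<h) ⟩
      0ℤ                     ∎)
    where
    zero-row : ∀ {h} → i ≢ h → (firstRows V i ⊙ x) h ≡ 0ℤ
    zero-row i≢h = subst (λ h → (firstRows V i ⊙ x) h ≡ 0ℤ) (Fin.punchIn-punchOut i≢h) (Wx≡0 (Fin.punchOut i≢h))

elementaryDivisors-∣ : ∀ {n} (s t : Fin n → ℕ) (U V : Matrix n n) →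
  (∀ i j → i Fin.≤ j → s i ∣ s j) → (∀ i j → i Fin.≤ j → t i ∣ t j) →
  U ⊗ diag (+_ ∘ s) ⊗ V ≈ diag (+_ ∘ t) → ∀ i → s i ∣ t i
elementaryDivisors-∣ s t U V s-chain t-chain UsV≈t i
  with x , x-primitive , Vx≡0 , x≡0 ← supportedKernel V i = x-primitive (s i) (t i) s∣tx
  where
  open ≡-Reasoning
  tx≡ : ∀ a → + t a ℤ.* x a ≡ ((U ⊗ diag (+_ ∘ s)) ⊙ V ⊙ x) a
  tx≡ a = begin
    + t a ℤ.* x a                      ≡⟨ diag-⊙ (+_ ∘ t) x a ⟨
    (diag (+_ ∘ t) ⊙ x) a              ≡⟨ sum-cong-≗ (λ h → cong (ℤ._* x h) (UsV≈t a h)) ⟨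
    ((U ⊗ diag (+_ ∘ s) ⊗ V) ⊙ x) a    ≡⟨ ⊙-assoc (U ⊗ diag (+_ ∘ s)) V x a ⟨
    ((U ⊗ diag (+_ ∘ s)) ⊙ V ⊙ x) a    ∎
  s∣summand : ∀ a h → + s i ℤ∣.∣ (U ⊗ diag (+_ ∘ s)) a h ℤ.* (V ⊙ x) h
  s∣summand a h with h Fin.<? i
  -- The terms with h < i vanish by the choice of x; in the others sᵢ ∣ sₕ.
  ... | yes h<i = ℤ∣.∣n⇒∣m*n ((U ⊗ diag (+_ ∘ s)) a h) (subst (+ s i ℤ∣.∣_) (sym (Vx≡0 h h<i)) (ℤ∣.∣ᵤ⇒∣ (_ ∣0)))
  ... | no  h≮i = ℤ∣.∣m⇒∣m*n ((V ⊙ x) h) (subst (+ s i ℤ∣.∣_) (sym (⊗-diag U (+_ ∘ s) a h))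
                    (ℤ∣.∣n⇒∣m*n (U a h) (ℤ∣.∣ᵤ⇒∣ (s-chain i h (ℕ.≮⇒≥ h≮i)))))
  s∣tx : ∀ a → s i ∣ t i ℕ.* ℤ.∣ x a ∣
  s∣tx a with i Fin.<? a
  ... | yes i<a = subst (s i ∣_) (sym (trans (cong (λ y → t i ℕ.* ℤ.∣ y ∣) (x≡0 a i<a)) (ℕ.*-zeroʳ (t i)))) (s i ∣0)
  ... | no  i≮a = ∣-trans
    (subst (s i ∣_) (ℤ.abs-* (+ t a) (x a)) (ℤ∣.∣⇒∣ᵤ (subst (+ s i ℤ∣.∣_) (sym (tx≡ a)) (∣-sum (s∣summand a)))))
    -- For a ≤ i the chain condition tₐ ∣ tᵢ replaces the varying factor tₐ by the fixed tᵢ, which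
    -- primitivity of x requires.
    (*-monoˡ-∣ ℤ.∣ x a ∣ (t-chain a i (ℕ.≮⇒≥ i≮a)))

Chain : ∀ {n} → Vec ℕ n → Set
Chain s = ∀ i j → i Fin.≤ j → lookup s i ∣ lookup s j

elementaryDivisors-unique : ∀ {n} {M : Matrix n n} {s t : Vec ℕ n} →
                            IsElementaryDivisors M s → IsElementaryDivisors M t → s ≡ t
elementaryDivisors-unique {M = M} {s} {t} (s-chain , M∼s) (t-chain , M∼t) = begin
  s                        ≡⟨ Vec.tabulate∘lookup s ⟨
  Vec.tabulate (lookup s)  ≡⟨ Vec.tabulate-cong (λ i → ∣-antisym (∣-from-∼ s t M∼s M∼t s-chain t-chain i) (∣-from-∼ t s M∼t M∼s t-chain s-chain i)) ⟩
  Vec.tabulate (lookup t)  ≡⟨ Vec.tabulate∘lookup t ⟩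
  t                        ∎
  where
  open ≡-Reasoning
  ∣-from-∼ : ∀ s t → M ∼ diag (λ i → + lookup s i) → M ∼ diag (λ i → + lookup t i) →
            Chain s → Chain t → ∀ i → lookup s i ∣ lookup t i
  ∣-from-∼ s t M∼s M∼t s-chain t-chain = from (∼-trans {L = diag (λ i → + lookup s i)} {M} {diag (λ i → + lookup t i)} (∼-sym M∼s) M∼t)
    where
    from : diag (λ i → + lookup s i) ∼ diag (λ i → + lookup t i) → ∀ i → lookup s i ∣ lookup t i
    from (U , V , _ , _ , UsV≈t) = elementaryDivisors-∣ (lookup s) (lookup t) U V s-chain t-chain UsV≈t

-- Division by monic polynomials

infixr 5 _◂_
-- Sequences are read as power series; `a ◂ F` is a + X F.
_◂_ : ℤ → (ℕ → ℤ) → ℕ → ℤ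
(a ◂ F) zero    = a
(a ◂ F) (suc i) = F i

◂-cong : ∀ {a b F G} → a ≡ b → F ≗ G → a ◂ F ≗ b ◂ G
◂-cong a≡b F≗G zero    = a≡b
◂-cong a≡b F≗G (suc i) = F≗G i

-- The shape F = x G + H with a single scalar covers additivity and homogeneity together; all
-- linearity lemmas below have it.
◂-linear : ∀ x {a b c F G H} → a ≡ x ℤ.* b ℤ.+ c → (∀ i → F i ≡ x ℤ.* G i ℤ.+ H i) →
           ∀ i → (a ◂ F) i ≡ x ℤ.* (b ◂ G) i ℤ.+ (c ◂ H) i
◂-linear x a≡ F≗ zero    = a≡
◂-linear x a≡ F≗ (suc i) = F≗ i

◂-zero : ∀ {F} → (∀ i → F i ≡ 0ℤ) → ∀ i → (0ℤ ◂ F) i ≡ 0ℤ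
◂-zero F≗0 zero    = refl
◂-zero F≗0 (suc i) = F≗0 i

coeff-∷ : ∀ a f → coeff (a ∷ f) ≗ a ◂ coeff f
coeff-∷ a f zero    = refl
coeff-∷ a f (suc i) = refl

-- Division by Xⁿ + … with coefficient sequence G, applied to the first N
-- coefficients of a sequence.
module Division (n : ℕ) (G : ℕ → ℤ) where

  -- One round of `divMod`, performed on whole sequences instead of vectors of length n: the
  -- coefficient at n is cancelled by the leading 1 of G rather than cut off. In this form linearity
  -- is an identity at each index.
  step : ℤ → (ℕ → ℤ) → ℕ → ℤ
  step a r i = (a ◂ r) i ℤ.- (a ◂ r) n ℤ.* G i

  step-linear : ∀ x {a b c F G′ H} → a ≡ x ℤ.* b ℤ.+ c → (∀ i → F i ≡ x ℤ.* G′ i ℤ.+ H i) →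
                ∀ i → step a F i ≡ x ℤ.* step b G′ i ℤ.+ step c H i
  step-linear x a≡ F≗ i
    rewrite ◂-linear x a≡ F≗ i | ◂-linear x a≡ F≗ n
    = solve 6 (λ x b c b′ c′ g → (x :* b :+ c) :- (x :* b′ :+ c′) :* g := x :* (b :- b′ :* g) :+ (c :- c′ :* g))
        refl x _ _ _ _ (G i)
    where open +-*-Solver

  step-cong : ∀ {a b F H} → a ≡ b → F ≗ H → step a F ≗ step b H
  step-cong a≡b F≗H i = cong₂ (λ u v → u ℤ.- v ℤ.* G i) (◂-cong a≡b F≗H i) (◂-cong a≡b F≗H n)

  step-zero : ∀ {F} → (∀ i → F i ≡ 0ℤ) → ∀ i → step 0ℤ F i ≡ 0ℤ
  step-zero F≗0 i = cong₂ (λ u v → u ℤ.- v ℤ.* G i) (◂-zero F≗0 i) (◂-zero F≗0 n)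

  remainder : ℕ → (ℕ → ℤ) → ℕ → ℤ
  remainder zero    F _ = 0ℤ
  remainder (suc N) F   = step (F 0) (remainder N (F ∘ suc))

  quotient : ℕ → (ℕ → ℤ) → ℕ → ℤ
  quotient zero    F _ = 0ℤ
  quotient (suc N) F   = (F 0 ◂ remainder N (F ∘ suc)) n ◂ quotient N (F ∘ suc)

  remainder-linear : ∀ N x {F G′ H} → (∀ i → F i ≡ x ℤ.* G′ i ℤ.+ H i) →
                     ∀ i → remainder N F i ≡ x ℤ.* remainder N G′ i ℤ.+ remainder N H i
  remainder-linear zero    x F≗ i = sym (trans (ℤ.+-identityʳ _) (ℤ.*-zeroʳ x))
  remainder-linear (suc N) x F≗   = step-linear x (F≗ 0) (remainder-linear N x (F≗ ∘ suc))

  quotient-linear : ∀ N x {F G′ H} → (∀ i → F i ≡ x ℤ.* G′ i ℤ.+ H i) →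
                    ∀ i → quotient N F i ≡ x ℤ.* quotient N G′ i ℤ.+ quotient N H i
  quotient-linear zero    x F≗ i = sym (trans (ℤ.+-identityʳ _) (ℤ.*-zeroʳ x))
  quotient-linear (suc N) x F≗   =
    ◂-linear x (◂-linear x (F≗ 0) (remainder-linear N x (F≗ ∘ suc)) n) (quotient-linear N x (F≗ ∘ suc))

  remainder-cong : ∀ N {F H} → F ≗ H → remainder N F ≗ remainder N H
  remainder-cong zero    F≗H _ = refl
  remainder-cong (suc N) F≗H   = step-cong (F≗H 0) (remainder-cong N (F≗H ∘ suc))

  quotient-cong : ∀ N {F H} → F ≗ H → quotient N F ≗ quotient N H
  quotient-cong zero    F≗H _ = refl
  quotient-cong (suc N) F≗H   =
    ◂-cong (◂-cong (F≗H 0) (remainder-cong N (F≗H ∘ suc)) n) (quotient-cong N (F≗H ∘ suc))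

  remainder-zero : ∀ N i → remainder N (λ _ → 0ℤ) i ≡ 0ℤ
  remainder-zero zero    = λ _ → refl
  remainder-zero (suc N) = step-zero (remainder-zero N)

  quotient-zero : ∀ N i → quotient N (λ _ → 0ℤ) i ≡ 0ℤ
  quotient-zero zero    i = refl
  quotient-zero (suc N) i = trans (◂-cong (◂-zero (remainder-zero N) n) (λ _ → refl) i) (◂-zero (quotient-zero N) i)

  -- With degree below N ≤ n, the coefficient at n is 0 in every round, so no multiple of G is ever
  -- subtracted.
  remainder-small : ∀ N {F} → N ≤ n → (∀ i → N ≤ i → F i ≡ 0ℤ) → remainder N F ≗ F
  remainder-small zero    N≤n F≡0 i = sym (F≡0 i z≤n)
  remainder-small (suc N) {F} N<n F≡0 i = begin
    step (F 0) (remainder N (F ∘ suc)) i                          ≡⟨ cong₂ (λ u v → u ℤ.- v ℤ.* G i) (same i) (same n) ⟩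
    F i ℤ.- F n ℤ.* G i                                           ≡⟨ cong (λ u → F i ℤ.- u ℤ.* G i) (F≡0 n N<n) ⟩
    F i ℤ.+ 0ℤ                                                    ≡⟨ ℤ.+-identityʳ (F i) ⟩
    F i                                                           ∎
    where
    open ≡-Reasoning
    same : F 0 ◂ remainder N (F ∘ suc) ≗ F
    same zero    = refl
    same (suc i) = remainder-small N (ℕ.<⇒≤ N<n) (λ i N≤i → F≡0 (suc i) (s≤s N≤i)) i

  quotient-small : ∀ N {F} → N ≤ n → (∀ i → N ≤ i → F i ≡ 0ℤ) → ∀ i → quotient N F i ≡ 0ℤ
  quotient-small zero    N≤n F≡0 i = refl
  quotient-small (suc N) {F} N<n F≡0 i = trans (◂-cong (trans (same n) (F≡0 n N<n)) (λ _ → refl) i)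
    (◂-zero (quotient-small N (ℕ.<⇒≤ N<n) (λ i N≤i → F≡0 (suc i) (s≤s N≤i))) i)
    where
    same : F 0 ◂ remainder N (F ∘ suc) ≗ F
    same zero    = refl
    same (suc i) = remainder-small N (ℕ.<⇒≤ N<n) (λ i N≤i → F≡0 (suc i) (s≤s N≤i)) i

  module _ (Gₙ≡1 : G n ≡ 1ℤ) (G≡0 : ∀ i → n ℕ.< i → G i ≡ 0ℤ) where

    private
      tail-small : G 0 ◂ remainder n (G ∘ suc) ≗ G
      tail-small zero    = refl
      tail-small (suc i) = remainder-small n ℕ.≤-refl (λ i n≤i → G≡0 (suc i) (s≤s n≤i)) i

    -- Only the outermost round subtracts anything: the tail of G has degree below n, and prepending
    -- the constant term restores G, whose coefficient at n is 1.
    remainder-self : ∀ i → remainder (suc n) G i ≡ 0ℤ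
    remainder-self i = begin
      step (G 0) (remainder n (G ∘ suc)) i  ≡⟨ cong₂ (λ u v → u ℤ.- v ℤ.* G i) (tail-small i) (trans (tail-small n) Gₙ≡1) ⟩
      G i ℤ.- 1ℤ ℤ.* G i                    ≡⟨ cong (ℤ._-_ (G i)) (ℤ.*-identityˡ (G i)) ⟩
      G i ℤ.- G i                           ≡⟨ ℤ.+-inverseʳ (G i) ⟩
      0ℤ                                    ∎
      where open ≡-Reasoning

    quotient-self : quotient (suc n) G ≗ 1ℤ ◂ λ _ → 0ℤ
    quotient-self = ◂-cong (trans (tail-small n) Gₙ≡1) (quotient-small n ℕ.≤-refl (λ i n≤i → G≡0 (suc i) (s≤s n≤i)))

toPoly-top : ∀ {n} (c : Vec ℤ n) → coeff (toPoly (n , c)) n ≡ 1ℤ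
toPoly-top []      = refl
toPoly-top (_ ∷ c) = toPoly-top c

toPoly-above : ∀ {n} (c : Vec ℤ n) i → n ℕ.< i → coeff (toPoly (n , c)) i ≡ 0ℤ
toPoly-above []      (suc i) _         = refl
toPoly-above (_ ∷ c) (suc i) (s≤s n<i) = toPoly-above c i n<i

length-toPoly : ∀ {n} (c : Vec ℤ n) → length (toPoly (n , c)) ≡ suc n
length-toPoly []      = refl
length-toPoly (_ ∷ c) = cong suc (length-toPoly c)

coeff-replicate : ∀ n i → coeff (Vec.toList (Vec.replicate n 0ℤ)) i ≡ 0ℤ
coeff-replicate zero    i       = refl
coeff-replicate (suc n) zero    = refl
coeff-replicate (suc n) (suc i) = coeff-replicate n i

module _ {n} (c : Vec ℤ n) where

  open Division n (coeff (toPoly (n , c)))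

  -- The vector drops its last entry y, while the sequence retains position n. They agree there
  -- because the monic divisor contributes y - y 1 = 0, and beyond it because everything is 0.
  divMod-step : ∀ (v : Vec ℤ (suc n)) →
    Vec.last v ≡ coeff (Vec.toList v) n ×
    (∀ i → coeff (Vec.toList (Vec.zipWith ℤ._-_ (Vec.init v) (Vec.map (Vec.last v ℤ.*_) c))) i ≡
           coeff (Vec.toList v) i ℤ.- coeff (Vec.toList v) n ℤ.* coeff (toPoly (n , c)) i)
  divMod-step v with ys , y , refl ← Vec.initLast v =
    sym (top ys) , λ i → trans (low ys c i) (cong (λ t → coeff (Vec.toList (ys Vec.∷ʳ y)) i ℤ.- t ℤ.* coeff (toPoly (n , c)) i) (sym (top ys)))
    where
    top : ∀ {m} (ys : Vec ℤ m) → coeff (Vec.toList (ys Vec.∷ʳ y)) m ≡ y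
    top []       = refl
    top (_ ∷ ys) = top ys
    low : ∀ {m} (ys c : Vec ℤ m) i → coeff (Vec.toList (Vec.zipWith ℤ._-_ ys (Vec.map (y ℤ.*_) c))) i ≡
          coeff (Vec.toList (ys Vec.∷ʳ y)) i ℤ.- y ℤ.* coeff (toPoly (m , c)) i
    low []       []      zero    = sym (trans (cong (ℤ._-_ y) (ℤ.*-identityʳ y)) (ℤ.+-inverseʳ y))
    low []       []      (suc i) = sym (cong (ℤ._-_ 0ℤ) (ℤ.*-zeroʳ y))
    low (x ∷ ys) (a ∷ c) zero    = refl
    low (x ∷ ys) (a ∷ c) (suc i) = low ys c i

  divMod-remainder : ∀ N f → length f ≤ N → coeff (f mod (n , c)) ≗ remainder N (coeff f)
  divMod-remainder N       []      _         i = trans (coeff-replicate n i) (sym (remainder-zero N i))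
  divMod-remainder (suc N) (a ∷ f) (s≤s f≤N) i =
    trans (proj₂ (divMod-step (a ∷ proj₂ (divMod c f))) i)
      (cong₂ (λ u v → u ℤ.- v ℤ.* coeff (toPoly (n , c)) i) (same i) (same n))
    where
    same : coeff (a ∷ f mod (n , c)) ≗ a ◂ remainder N (coeff f)
    same i = trans (coeff-∷ a _ i) (◂-cong refl (divMod-remainder N f f≤N) i)

  divMod-quotient : ∀ N f → length f ≤ N → coeff (proj₁ (divMod c f)) ≗ quotient N (coeff f)
  divMod-quotient N       []      _         i       = sym (quotient-zero N i)
  divMod-quotient (suc N) (a ∷ f) (s≤s f≤N) zero    =
    trans (proj₁ (divMod-step (a ∷ proj₂ (divMod c f))))
      (trans (coeff-∷ a _ n) (◂-cong refl (divMod-remainder N f f≤N) n))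
  divMod-quotient (suc N) (a ∷ f) (s≤s f≤N) (suc i) = divMod-quotient N f f≤N i

  -- `remainder-self` has the bound `suc n`. The detour through `divMod`, which has no bound,
  -- carries it over to every larger one.
  remainder-toPoly : ∀ N → n ℕ.< N → ∀ i → remainder N (coeff (toPoly (n , c))) i ≡ 0ℤ
  remainder-toPoly N n<N i = begin
    remainder N (coeff g) i        ≡⟨ divMod-remainder N g (ℕ.≤-trans (ℕ.≤-reflexive (length-toPoly c)) n<N) i ⟨
    coeff (g mod (n , c)) i        ≡⟨ divMod-remainder (suc n) g (ℕ.≤-reflexive (length-toPoly c)) i ⟩
    remainder (suc n) (coeff g) i  ≡⟨ remainder-self (toPoly-top c) (toPoly-above c) i ⟩
    0ℤ                             ∎
    where
    open ≡-Reasoning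
    g = toPoly (n , c)

  quotient-toPoly : ∀ N → n ℕ.< N → quotient N (coeff (toPoly (n , c))) ≗ 1ℤ ◂ λ _ → 0ℤ
  quotient-toPoly N n<N i = begin
    quotient N (coeff g) i        ≡⟨ divMod-quotient N g (ℕ.≤-trans (ℕ.≤-reflexive (length-toPoly c)) n<N) i ⟨
    coeff (proj₁ (divMod c g)) i  ≡⟨ divMod-quotient (suc n) g (ℕ.≤-reflexive (length-toPoly c)) i ⟩
    quotient (suc n) (coeff g) i  ≡⟨ quotient-self (toPoly-top c) (toPoly-above c) i ⟩
    (1ℤ ◂ λ _ → 0ℤ) i             ∎
    where
    open ≡-Reasoning
    g = toPoly (n , c)

-- h ⋆ F is the product of h with the power series F.
infixr 7 _⋆_
_⋆_ : Poly → (ℕ → ℤ) → ℕ → ℤ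
([]      ⋆ F) i = 0ℤ
((a ∷ h) ⋆ F) i = a ℤ.* F i ℤ.+ (0ℤ ◂ h ⋆ F) i

⋆-linear : ∀ h x {F G H} → (∀ i → F i ≡ x ℤ.* G i ℤ.+ H i) → ∀ i → (h ⋆ F) i ≡ x ℤ.* (h ⋆ G) i ℤ.+ (h ⋆ H) i
⋆-linear []      x         F≗ i = sym (trans (ℤ.+-identityʳ _) (ℤ.*-zeroʳ x))
⋆-linear (a ∷ h) x {F} {G} {H} F≗ i
  rewrite F≗ i | ◂-linear x {0ℤ} {0ℤ} {0ℤ} (sym (trans (ℤ.+-identityʳ _) (ℤ.*-zeroʳ x))) (⋆-linear h x F≗) i
  = solve 6 (λ a x g h u v → a :* (x :* g :+ h) :+ (x :* u :+ v) := x :* (a :* g :+ u) :+ (a :* h :+ v))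
      refl a x (G i) (H i) _ _
  where open +-*-Solver

⋆-cong : ∀ h {F G} → F ≗ G → h ⋆ F ≗ h ⋆ G
⋆-cong []      F≗G i = refl
⋆-cong (a ∷ h) F≗G i = cong₂ (λ u v → a ℤ.* u ℤ.+ v) (F≗G i) (◂-cong refl (⋆-cong h F≗G) i)

⋆-zero : ∀ h i → (h ⋆ (λ _ → 0ℤ)) i ≡ 0ℤ
⋆-zero []      i = refl
⋆-zero (a ∷ h) i = cong₂ ℤ._+_ (ℤ.*-zeroʳ a) (◂-zero (⋆-zero h) i)

⋆-shift : ∀ h F → h ⋆ (0ℤ ◂ F) ≗ 0ℤ ◂ h ⋆ F
⋆-shift []      F zero    = refl
⋆-shift []      F (suc i) = refl
⋆-shift (a ∷ h) F zero    = trans (ℤ.+-identityʳ _) (ℤ.*-zeroʳ a)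
⋆-shift (a ∷ h) F (suc i) = cong (ℤ._+_ (a ℤ.* F i)) (⋆-shift h F i)

-- Multiplications by two polynomials commute as operators on power series. Applied to the series 1
-- this gives `⋆-comm`, and the two together rearrange products of three factors in `·-swapʳ`.
⋆-exchange : ∀ f g F → f ⋆ g ⋆ F ≗ g ⋆ f ⋆ F
⋆-exchange []      g F i = sym (⋆-zero g i)
⋆-exchange (a ∷ f) g F i = begin
  a ℤ.* (g ⋆ F) i ℤ.+ (0ℤ ◂ f ⋆ g ⋆ F) i    ≡⟨ cong (ℤ._+_ (a ℤ.* (g ⋆ F) i)) (◂-cong refl (⋆-exchange f g F) i) ⟩
  a ℤ.* (g ⋆ F) i ℤ.+ (0ℤ ◂ g ⋆ f ⋆ F) i    ≡⟨ cong (ℤ._+_ (a ℤ.* (g ⋆ F) i)) (⋆-shift g (f ⋆ F) i) ⟨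
  a ℤ.* (g ⋆ F) i ℤ.+ (g ⋆ (0ℤ ◂ f ⋆ F)) i  ≡⟨ ⋆-linear g a (λ _ → refl) i ⟨
  (g ⋆ (a ∷ f) ⋆ F) i                       ∎
  where open ≡-Reasoning

coeff-⋆ : ∀ f → f ⋆ (1ℤ ◂ λ _ → 0ℤ) ≗ coeff f
coeff-⋆ []      i       = refl
coeff-⋆ (a ∷ f) zero    = trans (ℤ.+-identityʳ _) (ℤ.*-identityʳ a)
coeff-⋆ (a ∷ f) (suc i) = trans (cong₂ ℤ._+_ (ℤ.*-zeroʳ a) (coeff-⋆ f i)) (ℤ.+-identityˡ _)

⋆-comm : ∀ f g → f ⋆ coeff g ≗ g ⋆ coeff f
⋆-comm f g i = begin
  (f ⋆ coeff g) i                  ≡⟨ ⋆-cong f (coeff-⋆ g) i ⟨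
  (f ⋆ g ⋆ (1ℤ ◂ λ _ → 0ℤ)) i      ≡⟨ ⋆-exchange f g _ i ⟩
  (g ⋆ f ⋆ (1ℤ ◂ λ _ → 0ℤ)) i      ≡⟨ ⋆-cong g (coeff-⋆ f) i ⟩
  (g ⋆ coeff f) i                  ∎
  where open ≡-Reasoning

⋆-identity : ∀ F → [ 1ℤ ] ⋆ F ≗ F
⋆-identity F i = trans (cong₂ ℤ._+_ (ℤ.*-identityˡ (F i)) (◂-zero {λ _ → 0ℤ} (λ _ → refl) i)) (ℤ.+-identityʳ (F i))

module _ {n} (c : Vec ℤ n) where

  open Division n (coeff (toPoly (n , c)))

  private G = coeff (toPoly (n , c))

  -- By linearity (a + X h) G splits into a G, which leaves no remainder, and X (h G), where a round
  -- starting from 0 produces 0 again.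
  remainder-⋆ : ∀ h N → length h ℕ.+ n ≤ N → ∀ i → remainder N (h ⋆ G) i ≡ 0ℤ
  remainder-⋆ []      N       _         i = remainder-zero N i
  remainder-⋆ (a ∷ h) (suc N) (s≤s h≤N) i = begin
    remainder (suc N) ((a ∷ h) ⋆ G) i                                           ≡⟨ remainder-linear (suc N) a {G′ = G} {0ℤ ◂ h ⋆ G} (λ _ → refl) i ⟩
    a ℤ.* remainder (suc N) G i ℤ.+ step 0ℤ (remainder N (h ⋆ G)) i             ≡⟨ cong₂ (λ u v → a ℤ.* u ℤ.+ v)
                                                                                     (remainder-toPoly c (suc N) (s≤s (ℕ.≤-trans (ℕ.m≤n+m n (length h)) h≤N)) i)
                                                                                     (step-zero (remainder-⋆ h N h≤N) i) ⟩
    a ℤ.* 0ℤ ℤ.+ 0ℤ                                                             ≡⟨ trans (ℤ.+-identityʳ _) (ℤ.*-zeroʳ a) ⟩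
    0ℤ                                                                          ∎
    where open ≡-Reasoning

  quotient-⋆ : ∀ h N → length h ℕ.+ n ≤ N → quotient N (h ⋆ G) ≗ coeff h
  quotient-⋆ []      N       _         i = quotient-zero N i
  quotient-⋆ (a ∷ h) (suc N) (s≤s h≤N) i = begin
    quotient (suc N) ((a ∷ h) ⋆ G) i                               ≡⟨ quotient-linear (suc N) a {G′ = G} {0ℤ ◂ h ⋆ G} (λ _ → refl) i ⟩
    a ℤ.* quotient (suc N) G i ℤ.+ quotient (suc N) (0ℤ ◂ h ⋆ G) i  ≡⟨ cong₂ (λ u v → a ℤ.* u ℤ.+ v)
                                                                         (quotient-toPoly c (suc N) (s≤s (ℕ.≤-trans (ℕ.m≤n+m n (length h)) h≤N)) i)
                                                                         (◂-cong (◂-zero (remainder-⋆ h N h≤N) n) (quotient-⋆ h N h≤N) i) ⟩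
    a ℤ.* (1ℤ ◂ λ _ → 0ℤ) i ℤ.+ (0ℤ ◂ coeff h) i                   ≡⟨ cases i ⟩
    coeff (a ∷ h) i                                                ∎
    where
    open ≡-Reasoning
    cases : ∀ i → a ℤ.* (1ℤ ◂ λ _ → 0ℤ) i ℤ.+ (0ℤ ◂ coeff h) i ≡ coeff (a ∷ h) i
    cases zero    = trans (ℤ.+-identityʳ _) (ℤ.*-identityʳ a)
    cases (suc i) = trans (cong (ℤ._+ coeff h i) (ℤ.*-zeroʳ a)) (ℤ.+-identityˡ _)

-- Products and exact quotients of monic polynomials

degree : Monic → ℕ
degree = proj₁

coeff-toPoly-tabulate : ∀ n (F : ℕ → ℤ) → F n ≡ 1ℤ → (∀ i → n ℕ.< i → F i ≡ 0ℤ) →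
                        coeff (toPoly (n , Vec.tabulate (F ∘ toℕ))) ≗ F
coeff-toPoly-tabulate zero    F Fₙ≡1 F≡0 zero    = sym Fₙ≡1
coeff-toPoly-tabulate zero    F Fₙ≡1 F≡0 (suc i) = sym (F≡0 (suc i) (s≤s z≤n))
coeff-toPoly-tabulate (suc n) F Fₙ≡1 F≡0 zero    = refl
coeff-toPoly-tabulate (suc n) F Fₙ≡1 F≡0 (suc i) = coeff-toPoly-tabulate n (F ∘ suc) Fₙ≡1 (λ i n<i → F≡0 (suc i) (s≤s n<i)) i

Monic-ext : ∀ f g → degree f ≡ degree g → coeff (toPoly f) ≗ coeff (toPoly g) → f ≡ g
Monic-ext (n , b) (n , c) refl eq = cong (n ,_) (vec-ext b c eq)
  where
  vec-ext : ∀ {n} (b c : Vec ℤ n) → coeff (toPoly (n , b)) ≗ coeff (toPoly (n , c)) → b ≡ c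
  vec-ext []      []      eq = refl
  vec-ext (x ∷ b) (y ∷ c) eq = cong₂ _∷_ (eq 0) (vec-ext b c (eq ∘ suc))

infixl 7 _·_
_·_ : Monic → Monic → Monic
f · g = degree f ℕ.+ degree g , Vec.tabulate ((toPoly f ⋆ coeff (toPoly g)) ∘ toℕ)

⋆-top : ∀ {m} (b : Vec ℤ m) n F → F n ≡ 1ℤ → (∀ i → n ℕ.< i → F i ≡ 0ℤ) → (toPoly (m , b) ⋆ F) (m ℕ.+ n) ≡ 1ℤ
⋆-top []              n F Fₙ≡1 F≡0 = trans (⋆-identity F n) Fₙ≡1
⋆-top {suc m} (a ∷ b) n F Fₙ≡1 F≡0 = trans
  (cong₂ (λ u v → a ℤ.* u ℤ.+ v) (F≡0 (suc m ℕ.+ n) (s≤s (ℕ.m≤n+m n m))) (⋆-top b n F Fₙ≡1 F≡0))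
  (cong (ℤ._+ 1ℤ) (ℤ.*-zeroʳ a))

⋆-above : ∀ {m} (b : Vec ℤ m) n F → (∀ i → n ℕ.< i → F i ≡ 0ℤ) → ∀ i → m ℕ.+ n ℕ.< i → (toPoly (m , b) ⋆ F) i ≡ 0ℤ
⋆-above []      n F F≡0 i n<i = trans (⋆-identity F i) (F≡0 i n<i)
⋆-above {suc m} (a ∷ b) n F F≡0 (suc i) (s≤s m+n<i) = trans
  (cong₂ (λ u v → a ℤ.* u ℤ.+ v) (F≡0 (suc i) (s≤s (ℕ.≤-trans (ℕ.m≤n+m n (suc m)) m+n<i))) (⋆-above b n F F≡0 i m+n<i))
  (trans (ℤ.+-identityʳ _) (ℤ.*-zeroʳ a))

coeff-· : ∀ f g → coeff (toPoly (f · g)) ≗ toPoly f ⋆ coeff (toPoly g)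
coeff-· (m , b) (n , c) = coeff-toPoly-tabulate (m ℕ.+ n) _
  (⋆-top b n _ (toPoly-top c) (toPoly-above c)) (⋆-above b n _ (toPoly-above c))

-- The quotient sequence is that of `f`, hence 1 at the degree of `f` and 0 above. This justifies
-- that `÷` keeps the lower coefficients only and supplies the leading 1 by convention.
·-÷ : ∀ f g → (f · g) ÷ g ≡ f
·-÷ f@(m , b) g@(n , c) = Monic-ext ((f · g) ÷ g) f m+n∸n≡m λ i →
  trans (coeff-toPoly-tabulate (m ℕ.+ n ∸ n) q
    (trans (cong q m+n∸n≡m) (trans (q≗f m) (toPoly-top b)))
    (λ j lt → trans (q≗f j) (toPoly-above b j (subst (ℕ._< j) m+n∸n≡m lt))) i) (q≗f i)
  where
  open Division n (coeff (toPoly g))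
  m+n∸n≡m = ℕ.m+n∸n≡m m n
  q = coeff (proj₁ (divMod c (toPoly (f · g))))
  q≗f : q ≗ coeff (toPoly f)
  q≗f i = begin
    q i                                                              ≡⟨ divMod-quotient c (suc (m ℕ.+ n)) (toPoly (f · g)) (ℕ.≤-reflexive (length-toPoly (proj₂ (f · g)))) i ⟩
    quotient (suc (m ℕ.+ n)) (coeff (toPoly (f · g))) i              ≡⟨ quotient-cong (suc (m ℕ.+ n)) (coeff-· f g) i ⟩
    quotient (suc (m ℕ.+ n)) (toPoly f ⋆ coeff (toPoly g)) i         ≡⟨ quotient-⋆ c (toPoly f) (suc (m ℕ.+ n)) (ℕ.≤-reflexive (cong (ℕ._+ n) (length-toPoly b))) i ⟩
    coeff (toPoly f) i                                               ∎
    where open ≡-Reasoning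

-- Moves the factor `g` to the end, where `·-÷` can cancel it.
·-swapʳ : ∀ f g h → f · (g · h) ≡ f · h · g
·-swapʳ f g h = Monic-ext (f · (g · h)) (f · h · g)
  (trans (cong (degree f ℕ.+_) (ℕ.+-comm (degree g) (degree h))) (sym (ℕ.+-assoc (degree f) (degree h) (degree g)))) λ i → begin
  coeff (toPoly (f · (g · h))) i                   ≡⟨ coeff-· f (g · h) i ⟩
  (toPoly f ⋆ coeff (toPoly (g · h))) i            ≡⟨ ⋆-cong (toPoly f) (coeff-· g h) i ⟩
  (toPoly f ⋆ toPoly g ⋆ coeff (toPoly h)) i       ≡⟨ ⋆-exchange (toPoly f) (toPoly g) _ i ⟩
  (toPoly g ⋆ toPoly f ⋆ coeff (toPoly h)) i       ≡⟨ ⋆-cong (toPoly g) (coeff-· f h) i ⟨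
  (toPoly g ⋆ coeff (toPoly (f · h))) i            ≡⟨ ⋆-comm (toPoly g) (toPoly (f · h)) i ⟩
  (toPoly (f · h) ⋆ coeff (toPoly g)) i            ≡⟨ coeff-· (f · h) g i ⟨
  coeff (toPoly (f · h · g)) i                     ∎
  where open ≡-Reasoning

-- Powers of X modulo 1 + Xᵏ⁺¹ + … + Xᵇ⁽ᵏ⁺¹⁾

-- 1 + Xᵏ⁺¹ + … + Xᵇ⁽ᵏ⁺¹⁾
geometric : ℕ → ℕ → Monic
geometric k zero    = 0 , []
geometric k (suc b) = let n , c = geometric k b in suc k ℕ.+ n , 1ℤ ∷ Vec.replicate k 0ℤ Vec.++ c

degree-geometric : ∀ k b → degree (geometric k b) ≡ b ℕ.* suc k
degree-geometric k zero    = refl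
degree-geometric k (suc b) = cong (suc k ℕ.+_) (degree-geometric k b)

toPoly-replicate-++ : ∀ k {n} (c : Vec ℤ n) → toPoly (k ℕ.+ n , Vec.replicate k 0ℤ Vec.++ c) ≡ List.replicate k 0ℤ ++ toPoly (n , c)
toPoly-replicate-++ zero    c = refl
toPoly-replicate-++ (suc k) c = cong (0ℤ ∷_) (toPoly-replicate-++ k c)

toPoly-geometric : ∀ k b → toPoly (geometric k (suc b)) ≡ 1ℤ ∷ List.replicate k 0ℤ ++ toPoly (geometric k b)
toPoly-geometric k b = cong (1ℤ ∷_) (toPoly-replicate-++ k (proj₂ (geometric k b)))

shift : ℕ → (ℕ → ℤ) → ℕ → ℤ
shift zero    F = F
shift (suc k) F = 0ℤ ◂ shift k F

shift-cong : ∀ k {F G} → F ≗ G → shift k F ≗ shift k G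
shift-cong zero    F≗G = F≗G
shift-cong (suc k) F≗G = ◂-cong refl (shift-cong k F≗G)

shift-+ : ∀ k F G i → shift k F i ℤ.+ shift k G i ≡ shift k (λ i → F i ℤ.+ G i) i
shift-+ zero    F G i       = refl
shift-+ (suc k) F G zero    = refl
shift-+ (suc k) F G (suc i) = shift-+ k F G i

shift-shift : ∀ k l F → shift k (shift l F) ≗ shift (k ℕ.+ l) F
shift-shift zero    l F i = refl
shift-shift (suc k) l F   = ◂-cong refl (shift-shift k l F)

⋆-replicate : ∀ k h F → (List.replicate k 0ℤ ++ h) ⋆ F ≗ shift k (h ⋆ F)
⋆-replicate zero    h F i = refl
⋆-replicate (suc k) h F i = trans (cong₂ ℤ._+_ (ℤ.*-zeroˡ (F i)) (◂-cong refl (⋆-replicate k h F) i)) (ℤ.+-identityˡ _)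

coeff-X^[1+k]-1 : ∀ k → coeff (toPoly X^[1+ k ]-1) ≗ -1ℤ ◂ shift k (1ℤ ◂ λ _ → 0ℤ)
coeff-X^[1+k]-1 k zero    = refl
coeff-X^[1+k]-1 k (suc i) = go k i
  where
  go : ∀ k → coeff (toPoly (k , Vec.replicate k 0ℤ)) ≗ shift k (1ℤ ◂ λ _ → 0ℤ)
  go zero    zero    = refl
  go zero    (suc i) = refl
  go (suc k) zero    = refl
  go (suc k) (suc i) = go k i

-- Telescoping: with q = k + 1 and S the sum for b, (1 + X^q S)(X^q - 1) = (X^q - 1) + X^q
-- (X^((b+1)q) - 1). The index k + b (k + 1) is the exponent (b + 1) q less one.
geometric-⋆ : ∀ k b → toPoly (geometric k b) ⋆ coeff (toPoly X^[1+ k ]-1) ≗ coeff (toPoly X^[1+ k ℕ.+ b ℕ.* suc k ]-1)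
geometric-⋆ k zero i = begin
  ([ 1ℤ ] ⋆ coeff (toPoly X^[1+ k ]-1)) i    ≡⟨ ⋆-identity (coeff (toPoly X^[1+ k ]-1)) i ⟩
  coeff (toPoly X^[1+ k ]-1) i               ≡⟨ cong (λ k → coeff (toPoly X^[1+ k ]-1) i) (ℕ.+-identityʳ k) ⟨
  coeff (toPoly X^[1+ k ℕ.+ 0 ]-1) i         ∎
  where open ≡-Reasoning
geometric-⋆ k (suc b) i = begin
  (toPoly (geometric k (suc b)) ⋆ E) i                                    ≡⟨ cong (λ f → (f ⋆ E) i) (toPoly-geometric k b) ⟩
  1ℤ ℤ.* E i ℤ.+ (0ℤ ◂ (List.replicate k 0ℤ ++ toPoly (geometric k b)) ⋆ E) i
    ≡⟨ cong₂ ℤ._+_ (ℤ.*-identityˡ (E i)) (◂-cong refl (λ i → trans (⋆-replicate k (toPoly (geometric k b)) E i) (shift-cong k (geometric-⋆ k b) i)) i) ⟩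
  E i ℤ.+ (0ℤ ◂ shift k (coeff (toPoly X^[1+ m ]-1))) i                   ≡⟨ cong₂ ℤ._+_ (coeff-X^[1+k]-1 k i) (◂-cong refl (shift-cong k (coeff-X^[1+k]-1 m)) i) ⟩
  (-1ℤ ◂ shift k δ) i ℤ.+ (0ℤ ◂ shift k (-1ℤ ◂ shift m δ)) i              ≡⟨ telescope i ⟩
  (-1ℤ ◂ shift (k ℕ.+ suc m) δ) i                                         ≡⟨ coeff-X^[1+k]-1 (k ℕ.+ suc m) i ⟨
  coeff (toPoly X^[1+ k ℕ.+ suc b ℕ.* suc k ]-1) i                        ∎
  where
  open ≡-Reasoning
  δ = 1ℤ ◂ λ _ → 0ℤ
  E = coeff (toPoly X^[1+ k ]-1)
  m = k ℕ.+ b ℕ.* suc k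
  cancel : ∀ i → δ i ℤ.+ (-1ℤ ◂ shift m δ) i ≡ shift (suc m) δ i
  cancel zero    = refl
  cancel (suc i) = ℤ.+-identityˡ _
  telescope : ∀ i → (-1ℤ ◂ shift k δ) i ℤ.+ (0ℤ ◂ shift k (-1ℤ ◂ shift m δ)) i ≡ (-1ℤ ◂ shift (k ℕ.+ suc m) δ) i
  telescope zero    = refl
  telescope (suc i) = trans (shift-+ k δ _ i) (trans (shift-cong k cancel i) (shift-shift k (suc m) δ i))

geometric-· : ∀ k b → geometric k b · X^[1+ k ]-1 ≡ X^[1+ k ℕ.+ b ℕ.* suc k ]-1
geometric-· k b = Monic-ext (geometric k b · X^[1+ k ]-1) X^[1+ k ℕ.+ b ℕ.* suc k ]-1
  (trans (cong (ℕ._+ suc k) (degree-geometric k b)) (ℕ.+-comm (b ℕ.* suc k) (suc k)))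
  (λ i → trans (coeff-· (geometric k b) X^[1+ k ]-1 i) (geometric-⋆ k b i))

mod-linear : ∀ x f g h m → (∀ i → coeff f i ≡ x ℤ.* coeff g i ℤ.+ coeff h i) →
             ∀ i → coeff (f mod m) i ≡ x ℤ.* coeff (g mod m) i ℤ.+ coeff (h mod m) i
mod-linear x f g h (n , c) f≗ i = begin
  coeff (f mod (n , c)) i                                              ≡⟨ divMod-remainder c N f (ℕ.≤-trans (ℕ.m≤m+n _ _) (ℕ.m≤m+n _ _)) i ⟩
  remainder N (coeff f) i                                              ≡⟨ remainder-linear N x f≗ i ⟩
  x ℤ.* remainder N (coeff g) i ℤ.+ remainder N (coeff h) i            ≡⟨ cong₂ (λ u v → x ℤ.* u ℤ.+ v)
                                                                            (divMod-remainder c N g (ℕ.≤-trans (ℕ.m≤n+m (length g) (length f)) (ℕ.m≤m+n _ _)) i)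
                                                                            (divMod-remainder c N h (ℕ.m≤n+m _ _) i) ⟨
  x ℤ.* coeff (g mod (n , c)) i ℤ.+ coeff (h mod (n , c)) i            ∎
  where
  open ≡-Reasoning
  open Division n (coeff (toPoly (n , c)))
  -- A common bound for the three divisions.
  N = length f ℕ.+ length g ℕ.+ length h

shifted-mod : ∀ a m i → coeff ((List.replicate a 0ℤ ++ toPoly m) mod m) i ≡ 0ℤ
shifted-mod a m@(n , c) i = begin
  coeff (f mod m) i                                         ≡⟨ divMod-remainder c N f (ℕ.m≤m+n _ _) i ⟩
  -- Both the list `f` and the product of `X^ a` with `m` are the coefficients of `m` shifted by a
  -- places.
  remainder N (coeff f) i                                   ≡⟨ remainder-cong N (λ i → trans (sym (coeff-⋆ f i)) (trans (⋆-replicate a (toPoly m) _ i)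
                                                                 (trans (shift-cong a (coeff-⋆ (toPoly m)) i) (sym (trans (⋆-replicate a [ 1ℤ ] _ i) (shift-cong a (⋆-identity _) i)))))) i ⟩
  remainder N ((X^ a) ⋆ coeff (toPoly m)) i                 ≡⟨ remainder-⋆ c (X^ a) N (ℕ.m≤n+m _ (length f)) i ⟩
  0ℤ                                                        ∎
  where
  open ≡-Reasoning
  open Division n (coeff (toPoly m))
  f = List.replicate a 0ℤ ++ toPoly m
  N = length f ℕ.+ (length (X^ a) ℕ.+ n)

length-X^ : ∀ j → length (X^ j) ≡ suc j
length-X^ zero    = refl
length-X^ (suc j) = cong suc (length-X^ j)

X^-above : ∀ j i → j ℕ.< i → coeff (X^ j) i ≡ 0ℤ
X^-above zero    (suc i) _         = refl
X^-above (suc j) (suc i) (s≤s j<i) = X^-above j i j<i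

X^-mod-small : ∀ m j → j ℕ.< degree m → coeff ((X^ j) mod m) ≗ coeff (X^ j)
X^-mod-small (n , c) j j<n i = trans
  (divMod-remainder c (suc j) (X^ j) (ℕ.≤-reflexive (length-X^ j)) i)
  (remainder-small (suc j) j<n (X^-above j) i)
  where open Division n (coeff (toPoly (n , c)))

-- The modulus is independent of `b`: the induction on `b` splits off the lowest term Xᵃ and passes
-- from a to a + k + 1, while the modulus stays fixed. It becomes `geometric k b` only in
-- `geometric-relation`.
∑-X^-mod : ∀ m k b a r → coeff ((List.replicate a 0ℤ ++ toPoly (geometric k b)) mod m) r ≡
           sum {suc b} (λ i → coeff ((X^ (a ℕ.+ toℕ i ℕ.* suc k)) mod m) r)
∑-X^-mod m k zero    a r = trans (cong (λ a → coeff ((X^ a) mod m) r) (sym (ℕ.+-identityʳ a))) (sym (ℤ.+-identityʳ _))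
∑-X^-mod m k (suc b) a r = begin
  coeff ((List.replicate a 0ℤ ++ toPoly (geometric k (suc b))) mod m) r                                ≡⟨ cong (λ f → coeff ((List.replicate a 0ℤ ++ f) mod m) r) (toPoly-geometric k b) ⟩
  coeff ((List.replicate a 0ℤ ++ 1ℤ ∷ f) mod m) r                                                      ≡⟨ mod-linear 1ℤ (List.replicate a 0ℤ ++ 1ℤ ∷ f) (X^ a) (List.replicate a 0ℤ ++ 0ℤ ∷ f) m (split a) r ⟩
  1ℤ ℤ.* u a ℤ.+ coeff ((List.replicate a 0ℤ ++ List.replicate (suc k) 0ℤ ++ toPoly (geometric k b)) mod m) r
    ≡⟨ cong₂ ℤ._+_ (trans (ℤ.*-identityˡ (u a)) (cong u (sym (ℕ.+-identityʳ a)))) (cong (λ g → coeff (g mod m) r) (replicate-replicate a (suc k) _)) ⟩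
  u (a ℕ.+ 0) ℤ.+ coeff ((List.replicate (a ℕ.+ suc k) 0ℤ ++ toPoly (geometric k b)) mod m) r           ≡⟨ cong (ℤ._+_ (u (a ℕ.+ 0))) (∑-X^-mod m k b (a ℕ.+ suc k) r) ⟩
  u (a ℕ.+ 0) ℤ.+ sum {suc b} (λ i → u (a ℕ.+ suc k ℕ.+ toℕ i ℕ.* suc k))                               ≡⟨ cong (ℤ._+_ (u (a ℕ.+ 0))) (sum-cong-≗ {suc b} (λ i → cong u (ℕ.+-assoc a (suc k) (toℕ i ℕ.* suc k)))) ⟩
  sum {suc (suc b)} (λ i → u (a ℕ.+ toℕ i ℕ.* suc k))                                                  ∎
  where
  open ≡-Reasoning
  f = List.replicate k 0ℤ ++ toPoly (geometric k b)
  u = λ j → coeff ((X^ j) mod m) r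
  split : ∀ a i → coeff (List.replicate a 0ℤ ++ 1ℤ ∷ f) i ≡ 1ℤ ℤ.* coeff (X^ a) i ℤ.+ coeff (List.replicate a 0ℤ ++ 0ℤ ∷ f) i
  split zero    zero    = refl
  split zero    (suc i) = sym (ℤ.+-identityˡ _)
  split (suc a) zero    = refl
  split (suc a) (suc i) = split a i
  replicate-replicate : ∀ a b g → List.replicate a 0ℤ ++ List.replicate b 0ℤ ++ g ≡ List.replicate (a ℕ.+ b) 0ℤ ++ g
  replicate-replicate zero    b g = refl
  replicate-replicate (suc a) b g = cong (0ℤ ∷_) (replicate-replicate a b g)

geometric-relation : ∀ k b a r → sum {suc b} (λ i → coeff ((X^ (a ℕ.+ toℕ i ℕ.* suc k)) mod geometric k b) r) ≡ 0ℤ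
geometric-relation k b a r = trans (sym (∑-X^-mod (geometric k b) k b a r)) (shifted-mod a (geometric k b) r)

-- Xᵏ = 1 in ℤ[X]/(m), expressed by the remainders of all powers of X.
HasPeriod : ℕ → Monic → Set
HasPeriod k m = ∀ j r → coeff ((X^ (j ℕ.+ k)) mod m) r ≡ coeff ((X^ j) mod m) r

-- Subtract the relation for Xᵃ from the one for Xᵃ⁺ᵏ⁺¹.
geometric-period : ∀ k b → HasPeriod (suc b ℕ.* suc k) (geometric k b)
geometric-period k b j r = +ᶻ-cancelˡ (sum {b} (λ i → u (j ℕ.+ suc k ℕ.+ toℕ i ℕ.* suc k))) _ _ (begin
  sum {b} v ℤ.+ u (j ℕ.+ (suc k ℕ.+ b ℕ.* suc k))                   ≡⟨ cong₂ ℤ._+_ (sum-cong-≗ {b} λ i → cong (λ x → u (j ℕ.+ suc k ℕ.+ x ℕ.* suc k)) (sym (Fin.toℕ-inject₁ i)))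
                                                                       (cong u (trans (sym (ℕ.+-assoc j (suc k) _)) (cong (λ x → j ℕ.+ suc k ℕ.+ x ℕ.* suc k) (sym (Fin.toℕ-fromℕ b))))) ⟩
  sum {b} (w ∘ Fin.inject₁) ℤ.+ w (Fin.fromℕ b)                     ≡⟨ sum-init-last w ⟨
  sum {suc b} w                                                     ≡⟨ geometric-relation k b (j ℕ.+ suc k) r ⟩
  0ℤ                                                                ≡⟨ geometric-relation k b j r ⟨
  u (j ℕ.+ 0) ℤ.+ sum {b} (λ i → u (j ℕ.+ (suc k ℕ.+ toℕ i ℕ.* suc k)))  ≡⟨ cong₂ ℤ._+_ (cong u (ℕ.+-identityʳ j)) (sum-cong-≗ {b} (λ i → cong u (sym (ℕ.+-assoc j (suc k) _)))) ⟩
  u j ℤ.+ sum {b} v                                                 ≡⟨ ℤ.+-comm (u j) _ ⟩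
  sum {b} v ℤ.+ u j                                                 ∎)
  where
  open ≡-Reasoning
  u = λ j → coeff ((X^ j) mod geometric k b) r
  v : Fin b → ℤ
  v i = u (j ℕ.+ suc k ℕ.+ toℕ i ℕ.* suc k)
  w : Fin (suc b) → ℤ
  w i = u (j ℕ.+ suc k ℕ.+ toℕ i ℕ.* suc k)

-- The remainder of Xʲ (X - 1) is 0, and by linearity it is the difference of the remainders of Xʲ⁺¹
-- and Xʲ.
X-1-period : HasPeriod 1 X^[1+ 0 ]-1
X-1-period j r = begin
  u (j ℕ.+ 1)                               ≡⟨ cong u (ℕ.+-comm j 1) ⟩
  u (suc j)                                 ≡⟨ ℤ.+-identityˡ _ ⟨
  0ℤ ℤ.+ u (suc j)                          ≡⟨ cong (ℤ._+ u (suc j)) (ℤ.+-inverseʳ (u j)) ⟨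
  u j ℤ.- u j ℤ.+ u (suc j)                 ≡⟨ ℤ.+-assoc (u j) (ℤ.- u j) _ ⟩
  u j ℤ.+ (ℤ.- u j ℤ.+ u (suc j))           ≡⟨ cong (λ x → u j ℤ.+ (x ℤ.+ u (suc j))) (ℤ.-1*i≡-i (u j)) ⟨
  u j ℤ.+ (-1ℤ ℤ.* u j ℤ.+ u (suc j))       ≡⟨ cong (ℤ._+_ (u j)) (mod-linear -1ℤ (List.replicate j 0ℤ ++ toPoly X^[1+ 0 ]-1) (X^ j) (X^ suc j) X^[1+ 0 ]-1 (split j) r) ⟨
  u j ℤ.+ coeff ((List.replicate j 0ℤ ++ toPoly X^[1+ 0 ]-1) mod X^[1+ 0 ]-1) r  ≡⟨ cong (ℤ._+_ (u j)) (shifted-mod j X^[1+ 0 ]-1 r) ⟩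
  u j ℤ.+ 0ℤ                                ≡⟨ ℤ.+-identityʳ (u j) ⟩
  u j                                       ∎
  where
  open ≡-Reasoning
  u = λ j → coeff ((X^ j) mod X^[1+ 0 ]-1) r
  split : ∀ j i → coeff (List.replicate j 0ℤ ++ toPoly X^[1+ 0 ]-1) i ≡ -1ℤ ℤ.* coeff (X^ j) i ℤ.+ coeff (X^ suc j) i
  split zero    zero          = refl
  split zero    (suc zero)    = refl
  split zero    (suc (suc i)) = refl
  split (suc j) zero          = refl
  split (suc j) (suc i)       = split j i

HasPeriod-* : ∀ {k m} → HasPeriod k m → ∀ n → HasPeriod (n ℕ.* k) m
HasPeriod-* {k} {m} per zero    j r = cong (λ j → coeff ((X^ j) mod m) r) (ℕ.+-identityʳ j)
HasPeriod-* {k} {m} per (suc n) j r = begin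
  coeff ((X^ (j ℕ.+ (k ℕ.+ n ℕ.* k))) mod m) r  ≡⟨ cong (λ j → coeff ((X^ j) mod m) r) (ℕ.+-assoc j k _) ⟨
  coeff ((X^ (j ℕ.+ k ℕ.+ n ℕ.* k)) mod m) r    ≡⟨ HasPeriod-* {m = m} per n (j ℕ.+ k) r ⟩
  coeff ((X^ (j ℕ.+ k)) mod m) r                ≡⟨ per j r ⟩
  coeff ((X^ j) mod m) r                        ∎
  where open ≡-Reasoning

-- Cyclotomic polynomials of prime power order

filter-cong-∈ : ∀ {A : Set} {P Q : A → Set} (P? : Decidable P) (Q? : Decidable Q) xs →
                (∀ {x} → x ∈ₗ xs → P x → Q x) → (∀ {x} → x ∈ₗ xs → Q x → P x) → filter P? xs ≡ filter Q? xs
filter-cong-∈ P? Q? []       P⇒Q Q⇒P = refl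
filter-cong-∈ P? Q? (x ∷ xs) P⇒Q Q⇒P with filter-cong-∈ P? Q? xs (P⇒Q ∘ there) (Q⇒P ∘ there) | P? x | Q? x
... | eq | yes _  | yes _  = cong (x ∷_) eq
... | eq | no _   | no _   = eq
... | eq | yes px | no ¬qx = contradiction (P⇒Q (here refl) px) ¬qx
... | eq | no ¬px | yes qx = contradiction (Q⇒P (here refl) qx) ¬px

[1‥suc] : ∀ n → [1‥ suc n ] ≡ [1‥ n ] ++ [ suc n ]
[1‥suc] n = trans (cong (List.map suc) (sym (List.upTo-∷ʳ n))) (List.map-++ suc (upTo n) [ n ])

∈-[1‥]⇒≤ : ∀ {d n} → d ∈ₗ [1‥ n ] → d ≤ n
∈-[1‥]⇒≤ d∈ with _ , i∈ , refl ← ∈-map⁻ suc d∈ = ∈-upTo⁻ i∈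

-- As `zs` equals `xs ++ ys` only propositionally, the positions lie in unrelated `Fin` types and
-- are compared through `toℕ`.
lookup-++ˡ : ∀ {A : Set} {zs : List A} xs {ys} → zs ≡ xs ++ ys →
             ∀ i j → toℕ i ≡ toℕ j → List.lookup zs i ≡ List.lookup xs j
lookup-++ˡ (x ∷ xs) refl zero    zero    eq = refl
lookup-++ˡ (x ∷ xs) refl (suc i) (suc j) eq = lookup-++ˡ xs refl i j (ℕ.suc-injective eq)

lookup-++ʳ : ∀ {A : Set} {zs : List A} xs {ys} → zs ≡ xs ++ ys →
             ∀ i j → toℕ i ≡ length xs ℕ.+ toℕ j → List.lookup zs i ≡ List.lookup ys j
lookup-++ʳ []       {ys} refl i j eq = cong (List.lookup ys) (Fin.toℕ-injective eq)
lookup-++ʳ (x ∷ xs) refl (suc i) j eq = lookup-++ʳ xs refl i j (ℕ.suc-injective eq)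

∈-basis⇒∣ : ∀ k {d r} → (d , r) ∈ₗ basis k → d ∣ k
∈-basis⇒∣ k v∈
  with d , d∈ , v∈row ← find (∈-concatMap⁻ (λ d → List.map (d ,_) (upTo (φ d))) {xs = divisors k} v∈)
  with _ , _ , refl ← ∈-map⁻ (d ,_) v∈row
  = proj₂ (∈-filter⁻ (_∣? k) {xs = [1‥ k ]} d∈)

module PrimePower (p′ : ℕ) (p-prime : Prime (suc p′)) where

  p : ℕ
  p = suc p′

  1<p : 1 ℕ.< p
  1<p = ℕ.nonTrivial⇒n>1 p {{prime⇒nonTrivial p-prime}}

  p^-nonZero : ∀ e → ℕ.NonZero (p ^ e)
  p^-nonZero e = ℕ.m^n≢0 p e

  p^-< : ∀ e → p ^ e ℕ.< p ^ suc e
  p^-< e = ℕ.^-monoʳ-< p 1<p (ℕ.n<1+n e)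

  -- Let pᵉ⁺¹ = q d. By Euclid's lemma p divides q or d. In the first case one p cancels and d ∣ pᵉ.
  -- In the second d = d′ p with d′ ∣ pᵉ, and the induction hypothesis for d′ is multiplied by p.
  ∣p^suc : ∀ e {d} → d ∣ p ^ suc e → d ∣ p ^ e ⊎ d ≡ p ^ suc e
  ∣p^suc e {d} (divides q eq) with euclidsLemma q d p-prime (divides (p ^ e) (trans (sym eq) (ℕ.*-comm p (p ^ e))))
  ... | inj₁ (divides q′ refl) = inj₁ (divides q′ (ℕ.*-cancelˡ-≡ (p ^ e) (q′ ℕ.* d) p (begin
    p ℕ.* p ^ e        ≡⟨ eq ⟩
    q′ ℕ.* p ℕ.* d     ≡⟨ cong (ℕ._* d) (ℕ.*-comm q′ p) ⟩
    p ℕ.* q′ ℕ.* d     ≡⟨ ℕ.*-assoc p q′ d ⟩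
    p ℕ.* (q′ ℕ.* d)   ∎)))
    where open ≡-Reasoning
  ... | inj₂ (divides d′ refl) = cofactor e (divides q (ℕ.*-cancelʳ-≡ (p ^ e) (q ℕ.* d′) p
          (trans (ℕ.*-comm (p ^ e) p) (trans eq (sym (ℕ.*-assoc q d′ p))))))
    where
    cofactor : ∀ e {d′} → d′ ∣ p ^ e → d′ ℕ.* p ∣ p ^ e ⊎ d′ ℕ.* p ≡ p ^ suc e
    cofactor zero {d′} d′∣1 = inj₂ (trans (ℕ.*-comm d′ p) (cong (p ℕ.*_) (∣1⇒≡1 d′∣1)))
    cofactor (suc e) {d′} d′∣ with ∣p^suc e d′∣
    ... | inj₁ d′∣p^e = inj₁ (subst (d′ ℕ.* p ∣_) (ℕ.*-comm (p ^ e) p) (*-monoˡ-∣ p d′∣p^e))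
    ... | inj₂ refl   = inj₂ (ℕ.*-comm (p ^ suc e) p)

  ∣p^⇒power : ∀ e {d} → d ∣ p ^ e → ∃ λ i → i ≤ e × d ≡ p ^ i
  ∣p^⇒power zero    d∣ = 0 , z≤n , ∣1⇒≡1 d∣
  ∣p^⇒power (suc e) d∣ with ∣p^suc e d∣
  ... | inj₂ d≡ = suc e , ℕ.≤-refl , d≡
  ... | inj₁ d∣p^e with i , i≤e , d≡ ← ∣p^⇒power e d∣p^e = i , ℕ.m≤n⇒m≤1+n i≤e , d≡

  -- By `∣p^suc`, a divisor of pᵉ⁺¹ other than pᵉ⁺¹ divides pᵉ and so is at most pᵉ. Lengthening the
  -- range beyond pᵉ therefore adds no divisor until pᵉ⁺¹ is reached.
  divisors-truncated : ∀ e k → p ^ e ℕ.+ k ℕ.< p ^ suc e →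
                       filter (_∣? p ^ suc e) [1‥ p ^ e ℕ.+ k ] ≡ divisors (p ^ e)
  divisors-truncated e zero lt = trans (cong (filter (_∣? p ^ suc e) ∘ [1‥_]) (ℕ.+-identityʳ (p ^ e)))
    (filter-cong-∈ (_∣? p ^ suc e) (_∣? p ^ e) [1‥ p ^ e ]
      (λ d∈ d∣ → [ (λ d∣p^e → d∣p^e) , (λ { refl → contradiction (∈-[1‥]⇒≤ d∈) (ℕ.<⇒≱ (p^-< e)) }) ]′ (∣p^suc e d∣))
      (λ _ d∣ → ∣-trans d∣ (n∣m*n p)))
  divisors-truncated e (suc k) lt = begin
    filter D? [1‥ p ^ e ℕ.+ suc k ]                     ≡⟨ cong (filter D? ∘ [1‥_]) (ℕ.+-suc (p ^ e) k) ⟩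
    filter D? [1‥ suc d ]                               ≡⟨ cong (filter D?) ([1‥suc] d) ⟩
    filter D? ([1‥ d ] ++ [ suc d ])                    ≡⟨ List.filter-++ D? [1‥ d ] [ suc d ] ⟩
    filter D? [1‥ d ] ++ filter D? [ suc d ]            ≡⟨ cong₂ _++_ (divisors-truncated e k (ℕ.<-trans (ℕ.n<1+n d) 1+d<)) (List.filter-reject D? 1+d∤) ⟩
    divisors (p ^ e) ++ []                              ≡⟨ List.++-identityʳ _ ⟩
    divisors (p ^ e)                                    ∎
    where
    open ≡-Reasoning
    D? = _∣? p ^ suc e
    d = p ^ e ℕ.+ k
    1+d< : suc d ℕ.< p ^ suc e
    1+d< = subst (ℕ._< p ^ suc e) (ℕ.+-suc (p ^ e) k) lt
    1+d∤ : ¬ (suc d ∣ p ^ suc e)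
    1+d∤ 1+d∣ with ∣p^suc e 1+d∣
    ... | inj₁ 1+d∣p^e = ℕ.<⇒≱ (s≤s (ℕ.m≤m+n (p ^ e) k)) (∣⇒≤ {{p^-nonZero e}} 1+d∣p^e)
    ... | inj₂ 1+d≡    = ℕ.<⇒≢ 1+d< 1+d≡

  properDivisors-p^ : ∀ e → properDivisors (p ^ suc e) ≡ divisors (p ^ e)
  properDivisors-p^ e = trans (cong (filter (_∣? p ^ suc e) ∘ [1‥_]) (sym eq))
    (divisors-truncated e (p ^ suc e ∸ 1 ∸ p ^ e) (subst (ℕ._< p ^ suc e) (sym eq) (ℕ.≤-reflexive (ℕ.suc-pred (p ^ suc e) {{p^-nonZero (suc e)}}))))
    where
    eq : p ^ e ℕ.+ (p ^ suc e ∸ 1 ∸ p ^ e) ≡ p ^ suc e ∸ 1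
    eq = ℕ.m+[n∸m]≡n (ℕ.<⇒≤pred {n = p ^ suc e} (p^-< e))

  divisors-p^ : ∀ e → divisors (p ^ suc e) ≡ divisors (p ^ e) ++ [ p ^ suc e ]
  divisors-p^ e = begin
    filter D? [1‥ p ^ suc e ]                                   ≡⟨ cong (filter D? ∘ [1‥_]) eq ⟨
    filter D? [1‥ suc (p ^ suc e ∸ 1) ]                         ≡⟨ cong (filter D?) ([1‥suc] (p ^ suc e ∸ 1)) ⟩
    filter D? ([1‥ p ^ suc e ∸ 1 ] ++ [ suc (p ^ suc e ∸ 1) ])  ≡⟨ cong (λ k → filter D? ([1‥ p ^ suc e ∸ 1 ] ++ [ k ])) eq ⟩
    filter D? ([1‥ p ^ suc e ∸ 1 ] ++ [ p ^ suc e ])            ≡⟨ List.filter-++ D? [1‥ p ^ suc e ∸ 1 ] [ p ^ suc e ] ⟩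
    properDivisors (p ^ suc e) ++ filter D? [ p ^ suc e ]       ≡⟨ cong₂ _++_ (properDivisors-p^ e) (List.filter-accept D? ∣-refl) ⟩
    divisors (p ^ e) ++ [ p ^ suc e ]                           ∎
    where
    open ≡-Reasoning
    D? = _∣? p ^ suc e
    eq : suc (p ^ suc e ∸ 1) ≡ p ^ suc e
    eq = ℕ.suc-pred (p ^ suc e) {{p^-nonZero (suc e)}}

  -- The closed form of `Φ (p ^ i)`. `ℕ.pred` compensates for `geometric k` having exponents that
  -- are multiples of k + 1.
  Ψ : ℕ → Monic
  Ψ zero    = X^[1+ 0 ]-1
  Ψ (suc i) = geometric (ℕ.pred (p ^ i)) p′

  X^[p^_]-1 : ℕ → Monic
  X^[p^ i ]-1 = X^[1+ ℕ.pred (p ^ i) ]-1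

  Ψ-· : ∀ i → Ψ (suc i) · X^[p^ i ]-1 ≡ X^[p^ suc i ]-1
  Ψ-· i = trans (geometric-· (ℕ.pred (p ^ i)) p′) (cong X^[1+_]-1 (pred-+ (p ^ i) {{p^-nonZero i}}))
    where
    pred-+ : ∀ q .{{_ : ℕ.NonZero q}} → ℕ.pred q ℕ.+ p′ ℕ.* suc (ℕ.pred q) ≡ ℕ.pred (q ℕ.+ p′ ℕ.* q)
    pred-+ (suc q) = refl

  -- `foldr` divides by the last and largest divisor pʲ first. Since X^(pʲ) - 1 is `Ψ j` times
  -- X^(pʲ⁻¹) - 1, each division lowers j by one, and at j = 0 the factor X - 1 = `Ψ 0` goes away.
  -- The cofactor `M` is what survives.
  foldr-÷ : ∀ b M j → (∀ i → i ≤ j → Φ′ b (p ^ i) ≡ Ψ i) →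
            List.foldr (λ d f → f ÷ Φ′ b d) (M · X^[p^ j ]-1) (divisors (p ^ j)) ≡ M
  foldr-÷ b M zero    Φ≡Ψ = trans (cong ((M · X^[p^ 0 ]-1) ÷_) (Φ≡Ψ 0 z≤n)) (·-÷ M (Ψ 0))
  foldr-÷ b M (suc j) Φ≡Ψ = begin
    List.foldr F (M · X^[p^ suc j ]-1) (divisors (p ^ suc j))              ≡⟨ cong (List.foldr F (M · X^[p^ suc j ]-1)) (divisors-p^ j) ⟩
    List.foldr F (M · X^[p^ suc j ]-1) (divisors (p ^ j) ++ [ p ^ suc j ])  ≡⟨ List.foldr-++ F (M · X^[p^ suc j ]-1) (divisors (p ^ j)) [ p ^ suc j ] ⟩
    List.foldr F ((M · X^[p^ suc j ]-1) ÷ Φ′ b (p ^ suc j)) (divisors (p ^ j))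
      ≡⟨ cong (λ f → List.foldr F f (divisors (p ^ j))) (begin
          (M · X^[p^ suc j ]-1) ÷ Φ′ b (p ^ suc j)           ≡⟨ cong₂ (λ f g → (M · f) ÷ g) (sym (Ψ-· j)) (Φ≡Ψ (suc j) ℕ.≤-refl) ⟩
          (M · (Ψ (suc j) · X^[p^ j ]-1)) ÷ Ψ (suc j)        ≡⟨ cong (_÷ Ψ (suc j)) (·-swapʳ M (Ψ (suc j)) X^[p^ j ]-1) ⟩
          (M · X^[p^ j ]-1 · Ψ (suc j)) ÷ Ψ (suc j)          ≡⟨ ·-÷ (M · X^[p^ j ]-1) (Ψ (suc j)) ⟩
          M · X^[p^ j ]-1                                    ∎) ⟩
    List.foldr F (M · X^[p^ j ]-1) (divisors (p ^ j))                      ≡⟨ foldr-÷ b M j (λ i i≤j → Φ≡Ψ i (ℕ.m≤n⇒m≤1+n i≤j)) ⟩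
    M                                                                    ∎
    where
    open ≡-Reasoning
    F : ℕ → Monic → Monic
    F d f = f ÷ Φ′ b d

  -- The induction is on the depth bound `b`, which each recursive call of `Φ′` lowers. Keeping k
  -- apart from pⁱ allows matching on `suc k`, without which `Φ′` does not unfold.
  Φ′-p^ : ∀ b i {k} → k ≡ p ^ i → k ≤ b → Φ′ b k ≡ Ψ i
  Φ′-p^ b       i       {zero}  eq k≤b = contradiction (sym eq) (ℕ.≢-nonZero⁻¹ (p ^ i) {{p^-nonZero i}})
  Φ′-p^ (suc b) zero    {suc k} refl k≤b = refl
  Φ′-p^ (suc b) (suc i) {suc k} eq (s≤s k≤b) = begin
    List.foldr (λ d f → f ÷ Φ′ b d) X^[1+ k ]-1 (properDivisors (suc k))          ≡⟨ cong₂ (List.foldr (λ d f → f ÷ Φ′ b d))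
                                                                                      (trans (cong (X^[1+_]-1 ∘ ℕ.pred) eq) (sym (Ψ-· i)))
                                                                                      (trans (cong properDivisors eq) (properDivisors-p^ i)) ⟩
    List.foldr (λ d f → f ÷ Φ′ b d) (Ψ (suc i) · X^[p^ i ]-1) (divisors (p ^ i))    ≡⟨ foldr-÷ b (Ψ (suc i)) i (λ j j≤i → Φ′-p^ b j refl (p^j≤b j j≤i)) ⟩
    Ψ (suc i)                                                                     ∎
    where
    open ≡-Reasoning
    p^j≤b : ∀ j → j ≤ i → p ^ j ≤ b
    p^j≤b j j≤i = ℕ.≤-trans (ℕ.s≤s⁻¹ (ℕ.≤-trans (s≤s (ℕ.^-monoʳ-≤ p j≤i)) (ℕ.≤-trans (p^-< i) (ℕ.≤-reflexive (sym eq))))) k≤b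

  Φ-p^ : ∀ i → Φ (p ^ i) ≡ Ψ i
  Φ-p^ i = Φ′-p^ (p ^ i) i refl ℕ.≤-refl

  Ψ-period : ∀ i → HasPeriod (p ^ i) (Ψ i)
  Ψ-period zero    = X-1-period
  Ψ-period (suc i) = subst (λ q → HasPeriod (p ℕ.* q) (Ψ (suc i))) (ℕ.suc-pred (p ^ i) {{p^-nonZero i}}) (geometric-period (ℕ.pred (p ^ i)) p′)

  Φ-period : ∀ e {d} → d ∣ p ^ e → HasPeriod (p ^ e) (Φ d)
  Φ-period e d∣ with i , i≤e , refl ← ∣p^⇒power e d∣ =
    subst (HasPeriod (p ^ e)) (sym (Φ-p^ i))
      (subst (λ q → HasPeriod q (Ψ i)) p^e≡ (HasPeriod-* {m = Ψ i} (Ψ-period i) (p ^ (e ∸ i))))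
    where
    p^e≡ : p ^ (e ∸ i) ℕ.* p ^ i ≡ p ^ e
    p^e≡ = trans (sym (ℕ.^-distribˡ-+-* p (e ∸ i) i)) (cong (p ^_) (ℕ.m∸n+n≡m i≤e))

  basis-p^ : ∀ e → basis (p ^ suc e) ≡ basis (p ^ e) ++ List.applyUpTo (p ^ suc e ,_) (φ (p ^ suc e))
  basis-p^ e = begin
    concatMap row (divisors (p ^ suc e))                                       ≡⟨ cong (concatMap row) (divisors-p^ e) ⟩
    concatMap row (divisors (p ^ e) ++ [ p ^ suc e ])                          ≡⟨ List.concatMap-++ row (divisors (p ^ e)) [ p ^ suc e ] ⟩
    basis (p ^ e) ++ (row (p ^ suc e) ++ [])                                   ≡⟨ cong (basis (p ^ e) ++_) (trans (List.++-identityʳ _) (List.map-upTo (p ^ suc e ,_) (φ (p ^ suc e)))) ⟩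
    basis (p ^ e) ++ List.applyUpTo (p ^ suc e ,_) (φ (p ^ suc e))             ∎
    where
    open ≡-Reasoning
    row : ℕ → List (ℕ × ℕ)
    row d = List.map (d ,_) (upTo (φ d))

  -- By Gauss's identity in the form `length-basis`, the bases for pᵉ and pᵉ⁺¹ have these lengths,
  -- and by `basis-p^` they differ by `φ (p ^ suc e)` elements.
  φ-p^ : ∀ e → φ (p ^ suc e) ≡ p′ ℕ.* p ^ e
  φ-p^ e = ℕ.+-cancelˡ-≡ (p ^ e) _ _ (begin
    p ^ e ℕ.+ φ (p ^ suc e)                                                               ≡⟨ cong₂ ℕ._+_ (length-basis (p ^ e)) (List.length-applyUpTo (p ^ suc e ,_) (φ (p ^ suc e))) ⟨
    length (basis (p ^ e)) ℕ.+ length (List.applyUpTo (p ^ suc e ,_) (φ (p ^ suc e)))     ≡⟨ List.length-++ (basis (p ^ e)) ⟨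
    length (basis (p ^ e) ++ List.applyUpTo (p ^ suc e ,_) (φ (p ^ suc e)))               ≡⟨ cong length (basis-p^ e) ⟨
    length (basis (p ^ suc e))                                                            ≡⟨ length-basis (p ^ suc e) ⟩
    p ^ suc e                                                                             ∎)
    where open ≡-Reasoning

-- The matrix A (p ^ suc e)

coeff-X^-≡ : ∀ j → coeff (X^ j) j ≡ 1ℤ
coeff-X^-≡ zero    = refl
coeff-X^-≡ (suc j) = coeff-X^-≡ j

coeff-X^-≢ : ∀ j i → i ≢ j → coeff (X^ j) i ≡ 0ℤ
coeff-X^-≢ zero    zero    i≢j = contradiction refl i≢j
coeff-X^-≢ zero    (suc i) i≢j = refl
coeff-X^-≢ (suc j) zero    i≢j = refl
coeff-X^-≢ (suc j) (suc i) i≢j = coeff-X^-≢ j i (i≢j ∘ cong suc)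

sum-coeff-X^ : ∀ m (F : ℕ → ℤ) j → j ℕ.< m → sum {m} (λ h → F (toℕ h) ℤ.* coeff (X^ j) (toℕ h)) ≡ F j
sum-coeff-X^ m F j j<m = begin
  sum {m} (λ h → F (toℕ h) ℤ.* coeff (X^ j) (toℕ h))  ≡⟨ sum-single (Fin.fromℕ< j<m) (λ h h≢ → trans (cong (F (toℕ h) ℤ.*_)
                                                            (coeff-X^-≢ j (toℕ h) (λ h≡j → h≢ (Fin.toℕ-injective (trans h≡j (sym (Fin.toℕ-fromℕ< j<m)))))))
                                                            (ℤ.*-zeroʳ (F (toℕ h)))) ⟩
  F (toℕ (Fin.fromℕ< j<m)) ℤ.* coeff (X^ j) (toℕ (Fin.fromℕ< j<m))  ≡⟨ cong (λ h → F h ℤ.* coeff (X^ j) h) (Fin.toℕ-fromℕ< j<m) ⟩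
  F j ℤ.* coeff (X^ j) j                              ≡⟨ cong (F j ℤ.*_) (coeff-X^-≡ j) ⟩
  F j ℤ.* 1ℤ                                          ≡⟨ ℤ.*-identityʳ (F j) ⟩
  F j                                                 ∎
  where open ≡-Reasoning

-- An entry of `A` with the column index extended to all exponents, so that periodicity and the
-- relation from Φ can be stated beyond the columns of one matrix.
coordinate : ℕ × ℕ → ℕ → ℤ
coordinate (d , r) j = coeff ((X^ j) mod Φ d) r

module Step (p′ : ℕ) (p-prime : Prime (suc p′)) (e : ℕ) where

  open PrimePower p′ p-prime

  -- Written as p′ pᵉ instead of `φ (p ^ suc e)`, m makes `p ^ suc e` compute to n + m.
  n m : ℕ
  n = p ^ e
  m = p′ ℕ.* p ^ e

  index : Fin n → ℕ × ℕ
  index i = List.lookup (basis n) (Fin.cast (sym (length-basis n)) i)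

  index-top : ∀ i → List.lookup (basis (p ^ suc e)) (Fin.cast (sym (length-basis (p ^ suc e))) (i ↑ˡ m)) ≡ index i
  index-top i = lookup-++ˡ (basis n) (basis-p^ e) _ _ (begin
    toℕ (Fin.cast (sym (length-basis (p ^ suc e))) (i ↑ˡ m))  ≡⟨ Fin.toℕ-cast (sym (length-basis (p ^ suc e))) (i ↑ˡ m) ⟩
    toℕ (i ↑ˡ m)                                              ≡⟨ Fin.toℕ-↑ˡ i m ⟩
    toℕ i                                                     ≡⟨ Fin.toℕ-cast (sym (length-basis n)) i ⟨
    toℕ (Fin.cast (sym (length-basis n)) i)                   ∎)
    where open ≡-Reasoning

  index-bottom : ∀ r → List.lookup (basis (p ^ suc e)) (Fin.cast (sym (length-basis (p ^ suc e))) (n ↑ʳ r)) ≡ (p ^ suc e , toℕ r)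
  index-bottom r = trans
    (lookup-++ʳ (basis n) (basis-p^ e) _ (Fin.cast (sym eq) r) (begin
      toℕ (Fin.cast (sym (length-basis (p ^ suc e))) (n ↑ʳ r))  ≡⟨ Fin.toℕ-cast (sym (length-basis (p ^ suc e))) (n ↑ʳ r) ⟩
      toℕ (n ↑ʳ r)                                              ≡⟨ Fin.toℕ-↑ʳ n r ⟩
      n ℕ.+ toℕ r                                               ≡⟨ cong₂ ℕ._+_ (length-basis n) (Fin.toℕ-cast (sym eq) r) ⟨
      length (basis n) ℕ.+ toℕ (Fin.cast (sym eq) r)            ∎))
    (trans (List.lookup-applyUpTo (p ^ suc e ,_) (φ (p ^ suc e)) (Fin.cast (sym eq) r)) (cong (p ^ suc e ,_) (Fin.toℕ-cast (sym eq) r)))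
    where
    open ≡-Reasoning
    eq : length (List.applyUpTo (p ^ suc e ,_) (φ (p ^ suc e))) ≡ m
    eq = trans (List.length-applyUpTo (p ^ suc e ,_) (φ (p ^ suc e))) (φ-p^ e)

  coordinate-period : ∀ i j b → coordinate (index i) (j ℕ.+ b ℕ.* n) ≡ coordinate (index i) j
  coordinate-period i j b = HasPeriod-* {m = Φ (proj₁ (index i))}
    (Φ-period e (∈-basis⇒∣ n (∈-lookup (Fin.cast (sym (length-basis n)) i)))) b j (proj₂ (index i))

  suc-pred-n : suc (ℕ.pred n) ≡ n
  suc-pred-n = ℕ.suc-pred n {{p^-nonZero e}}

  degree-Φ : degree (Φ (p ^ suc e)) ≡ m
  degree-Φ = trans (cong degree (Φ-p^ (suc e))) (trans (degree-geometric (ℕ.pred n) p′) (cong (p′ ℕ.*_) suc-pred-n))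

  coordinate-small : ∀ r j → j ℕ.< m → coordinate (p ^ suc e , r) j ≡ coeff (X^ j) r
  coordinate-small r j j<m = X^-mod-small (Φ (p ^ suc e)) j (subst (j ℕ.<_) (sym degree-Φ) j<m) r

  coordinate-relation : ∀ r a → sum {suc p′} (λ b → coordinate (p ^ suc e , r) (a ℕ.+ toℕ b ℕ.* n)) ≡ 0ℤ
  coordinate-relation r a = begin
    sum {suc p′} (λ b → coeff ((X^ (a ℕ.+ toℕ b ℕ.* n)) mod Φ (p ^ suc e)) r)
      ≡⟨ sum-cong-≗ {suc p′} (λ b → cong₂ (λ q g → coeff ((X^ (a ℕ.+ toℕ b ℕ.* q)) mod g) r) (sym suc-pred-n) (Φ-p^ (suc e))) ⟩
    sum {suc p′} (λ b → coeff ((X^ (a ℕ.+ toℕ b ℕ.* suc (ℕ.pred n))) mod Ψ (suc e)) r)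
      ≡⟨ geometric-relation (ℕ.pred n) p′ a r ⟩
    0ℤ ∎
    where open ≡-Reasoning

  a+bn<m : ∀ (a : Fin n) (b : Fin p′) → toℕ a ℕ.+ toℕ b ℕ.* n ℕ.< m
  a+bn<m a b = ℕ.≤-trans (ℕ.+-monoˡ-< (toℕ b ℕ.* n) (Fin.toℕ<n a)) (ℕ.*-monoˡ-≤ n (Fin.toℕ<n b))

  -- `P` and `Q` are the rows for the summands with d ∣ n, `L` the rows for pᵉ⁺¹. The exponent a +
  -- m, in this order, is a + p′ n by computation, as periodicity and the relation expect it.
  P : Matrix n m
  P i j = coordinate (index i) (toℕ j)

  Q : Matrix n n
  Q i a = coordinate (index i) (toℕ a ℕ.+ m)

  L : Matrix m n
  L r a = coordinate (p ^ suc e , toℕ r) (toℕ a ℕ.+ m)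

  -- XᵃΦ = 0 in the last summand expresses Xᵃ⁺ᵐ through the Xᵃ⁺ᵇⁿ with b < p′, whose exponents are
  -- below m, so that they are their own remainders.
  L≈ : ∀ r a → L r a ≡ ℤ.- sum {p′} (λ b → coeff (X^ (toℕ a ℕ.+ toℕ b ℕ.* n)) (toℕ r))
  L≈ r a = +ᶻ-inverseʳ-unique _ _ (begin
    sum {p′} (λ b → coeff (X^ (toℕ a ℕ.+ toℕ b ℕ.* n)) (toℕ r)) ℤ.+ L r a
      ≡⟨ cong₂ ℤ._+_ (sum-cong-≗ {p′} λ b → trans (sym (coordinate-small (toℕ r) _ (a+bn<m a b))) (cong v (sym (Fin.toℕ-inject₁ b)))) (cong v (sym (Fin.toℕ-fromℕ p′))) ⟩
    sum {p′} (w ∘ Fin.inject₁) ℤ.+ w (Fin.fromℕ p′)  ≡⟨ sum-init-last w ⟨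
    sum {suc p′} w                                   ≡⟨ coordinate-relation (toℕ r) (toℕ a) ⟩
    0ℤ                                               ∎)
    where
    open ≡-Reasoning
    v : ℕ → ℤ
    v b = coordinate (p ^ suc e , toℕ r) (toℕ a ℕ.+ b ℕ.* n)
    w : Fin (suc p′) → ℤ
    w b = v (toℕ b)

  sum-const : ∀ k (x : ℤ) → sum {k} (λ _ → x) ≡ + k ℤ.* x
  sum-const zero    x = sym (ℤ.*-zeroˡ x)
  sum-const (suc k) x = trans (cong (ℤ._+_ x) (sum-const k x)) (sym (ℤ.suc-* (+ k) x))

  -- By `L≈`, subtracting `P L` adds to column a of `Q` the columns a + bn of `P` for b < p′. As Xⁿ
  -- = 1 in the summands with d ∣ n, each of these p′ + 1 = p columns equals column a of `A n`.
  Q-PL≈pA : Q ⊞ ⊟ P ⊗ L ≈ (λ i a → + p ℤ.* A n i a)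
  Q-PL≈pA i a = begin
    Q i a ℤ.+ (⊟ P ⊗ L) i a                                     ≡⟨ cong₂ ℤ._+_ (coordinate-period i (toℕ a) p′) (begin
      sum {m} (λ h → ℤ.- P i h ℤ.* L h a)                         ≡⟨ sum-cong-≗ {m} (λ h → trans (cong (ℤ.- P i h ℤ.*_) (L≈ h a)) (neg-*-neg (P i h) (sum {p′} (λ b → X b h)))) ⟩
      sum {m} (λ h → P i h ℤ.* sum {p′} (λ b → X b h))            ≡⟨ sum-cong-≗ {m} (λ h → *-distribˡ-sum {p′} (P i h) (λ b → X b h)) ⟩
      sum {m} (λ h → sum {p′} (λ b → P i h ℤ.* X b h))            ≡⟨ ∑-comm {m} {p′} (λ h b → P i h ℤ.* X b h) ⟩
      sum {p′} (λ b → sum {m} (λ h → P i h ℤ.* X b h))            ≡⟨ sum-cong-≗ {p′} (λ b → trans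
                                                                        (sum-coeff-X^ m (coordinate (index i)) (toℕ a ℕ.+ toℕ b ℕ.* n) (a+bn<m a b))
                                                                        (coordinate-period i (toℕ a) (toℕ b))) ⟩
      sum {p′} (λ b → A n i a)                                    ≡⟨ sum-const p′ (A n i a) ⟩
      + p′ ℤ.* A n i a                                            ∎) ⟩
    A n i a ℤ.+ + p′ ℤ.* A n i a                                ≡⟨ ℤ.suc-* (+ p′) (A n i a) ⟨
    + p ℤ.* A n i a                                             ∎
    where
    open ≡-Reasoning
    X : Fin p′ → Fin m → ℤ
    X b h = coeff (X^ (toℕ a ℕ.+ toℕ b ℕ.* n)) (toℕ h)
    neg-*-neg : ∀ x y → ℤ.- x ℤ.* ℤ.- y ≡ x ℤ.* y
    neg-*-neg x y = trans (sym (ℤ.neg-distribˡ-* x (ℤ.- y))) (trans (cong ℤ.-_ (sym (ℤ.neg-distribʳ-* x y))) (ℤ.neg-involutive (x ℤ.* y)))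

  -- The columns are split into the first m and the last n, the rows into the
  -- first n and the last m.
  recast : Fin (m ℕ.+ n) → Fin (n ℕ.+ m)
  recast = Fin.cast (ℕ.+-comm m n)

  A-block : (λ i j → A (p ^ suc e) i (recast j)) ≈ block P Q 𝟙 L
  -- Both indices are rewritten as joins of their splittings, so that `cases` runs over the four
  -- blocks.
  A-block i j = subst (λ i → A (p ^ suc e) i (recast j) ≡ block P Q 𝟙 L i j) (Fin.join-splitAt n m i)
    (subst (λ j → A (p ^ suc e) (Fin.join n m (splitAt n i)) (recast j) ≡ block P Q 𝟙 L (Fin.join n m (splitAt n i)) j) (Fin.join-splitAt m n j)
      (trans (cases (splitAt n i) (splitAt m j)) (sym (cong₂ (entry P Q 𝟙 L) (Fin.splitAt-join n m (splitAt n i)) (Fin.splitAt-join m n (splitAt m j))))))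
    where
    left : ∀ (j : Fin m) → toℕ (recast (j ↑ˡ n)) ≡ toℕ j
    left j = trans (Fin.toℕ-cast (ℕ.+-comm m n) (j ↑ˡ n)) (Fin.toℕ-↑ˡ j n)
    right : ∀ (a : Fin n) → toℕ (recast (m ↑ʳ a)) ≡ toℕ a ℕ.+ m
    right a = trans (Fin.toℕ-cast (ℕ.+-comm m n) (m ↑ʳ a)) (trans (Fin.toℕ-↑ʳ m a) (ℕ.+-comm m (toℕ a)))
    X^-𝟙 : ∀ (r j : Fin m) → coeff (X^ toℕ j) (toℕ r) ≡ 𝟙 r j
    X^-𝟙 r j with r Fin.≟ j
    ... | yes refl = coeff-X^-≡ (toℕ r)
    ... | no  r≢j  = coeff-X^-≢ (toℕ j) (toℕ r) (r≢j ∘ Fin.toℕ-injective)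
    cases : ∀ x y → A (p ^ suc e) (Fin.join n m x) (recast (Fin.join m n y)) ≡ entry P Q 𝟙 L x y
    cases (inj₁ i) (inj₁ j) = cong₂ coordinate (index-top i) (left j)
    cases (inj₁ i) (inj₂ a) = cong₂ coordinate (index-top i) (right a)
    cases (inj₂ r) (inj₁ j) = trans (cong₂ coordinate (index-bottom r) (left j))
      (trans (coordinate-small (toℕ r) (toℕ j) (Fin.toℕ<n j)) (X^-𝟙 r j))
    cases (inj₂ r) (inj₂ a) = cong₂ coordinate (index-bottom r) (right a)

  A-∼ : A (p ^ suc e) ∼ block (𝟙 {m}) 𝟘 𝟘 (λ i j → + p ℤ.* A n i j)
  A-∼ = ∼-trans {M = block P Q 𝟙 L}
    (∼-respʳ-≈ {M = A (p ^ suc e)} A-block (reindex-columns recast (Fin.cast (ℕ.+-comm n m))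
      (Fin.cast-involutive (ℕ.+-comm m n) (ℕ.+-comm n m)) (Fin.cast-involutive (ℕ.+-comm n m) (ℕ.+-comm m n)) (A (p ^ suc e))))
    (∼-respʳ-≈ {M = block P Q 𝟙 L} (block-cong (λ _ _ → refl) (λ _ _ → refl) (λ _ _ → refl) Q-PL≈pA) (pivot P Q L))

-- The elementary divisors of A (p ^ e)

diag-cong : ∀ {n} {s t : Fin n → ℤ} → s ≗ t → diag s ≈ diag t
diag-cong s≗t i j with i Fin.≟ j
... | yes _ = s≗t i
... | no  _ = refl

*-diag : ∀ {n} x (s : Fin n → ℤ) → (λ i j → x ℤ.* diag s i j) ≈ diag (λ i → x ℤ.* s i)
*-diag x s i j with i Fin.≟ j
... | yes _ = refl
... | no  _ = ℤ.*-zeroʳ x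

module _ {A : Set} {P : A → Set} (P? : Decidable P) where

  count-accept : ∀ {n x} (xs : Vec A n) → P x → Vec.count P? (x ∷ xs) ≡ suc (Vec.count P? xs)
  count-accept {x = x} xs px with P? x
  ... | yes _  = refl
  ... | no ¬px = contradiction px ¬px

  count-reject : ∀ {n x} (xs : Vec A n) → ¬ P x → Vec.count P? (x ∷ xs) ≡ Vec.count P? xs
  count-reject {x = x} xs ¬px with P? x
  ... | yes px = contradiction px ¬px
  ... | no _   = refl

module Divisors (p : ℕ) (1<p : 1 ℕ.< p) where

  -- The diagonal of 1 ⊕ p D for D with diagonal `s`. The ones come first, as the divisibility chain
  -- demands.
  1^_++p·_ : ∀ m {n} → Vec ℕ n → Vec ℕ (m ℕ.+ n)
  1^ m ++p· s = Vec.replicate m 1 Vec.++ Vec.map (p ℕ.*_) s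

  chain-step : ∀ m {n} {s : Vec ℕ n} → Chain s → Chain (1^ m ++p· s)
  chain-step zero {s = s} s-chain i j i≤j
    rewrite Vec.lookup-map i (p ℕ.*_) s | Vec.lookup-map j (p ℕ.*_) s = *-monoʳ-∣ p (s-chain i j i≤j)
  chain-step (suc m) s-chain zero    j       i≤j       = 1∣ _
  chain-step (suc m) s-chain (suc i) (suc j) (s≤s i≤j) = chain-step m s-chain i j i≤j

  lookup-step : ∀ m {n} (s : Vec ℕ n) i →
                [ (λ _ → 1ℤ) , (λ i → + p ℤ.* + lookup s i) ]′ (splitAt m i) ≡ + lookup (1^ m ++p· s) i
  lookup-step zero    s i       = trans (sym (ℤ.pos-* p (lookup s i))) (cong +_ (sym (Vec.lookup-map i (p ℕ.*_) s)))
  lookup-step (suc m) s zero    = refl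
  lookup-step (suc m) s (suc i) with splitAt m i | lookup-step m s i
  ... | inj₁ _ | eq = eq
  ... | inj₂ _ | eq = eq

  block-step : ∀ m {n} (s : Vec ℕ n) →
               block (𝟙 {m}) 𝟘 𝟘 (λ i j → + p ℤ.* diag (λ i → + lookup s i) i j) ≈ diag (λ i → + lookup (1^ m ++p· s) i)
  block-step m s = begin
    block 𝟙 𝟘 𝟘 (λ i j → + p ℤ.* diag (λ i → + lookup s i) i j)                   ≈⟨ block-cong (λ _ _ → refl) (λ _ _ → refl) (λ _ _ → refl) (*-diag (+ p) (λ i → + lookup s i)) ⟩
    block 𝟙 𝟘 𝟘 (diag (λ i → + p ℤ.* + lookup s i))                               ≈⟨ block-diag (λ _ → 1ℤ) (λ i → + p ℤ.* + lookup s i) ⟩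
    diag ([ (λ _ → 1ℤ) , (λ i → + p ℤ.* + lookup s i) ]′ ∘ splitAt m)             ≈⟨ diag-cong (lookup-step m s) ⟩
    diag (λ i → + lookup (1^ m ++p· s) i)                                         ∎
    where open ≈-Reasoning

  p*x≢1 : ∀ x → p ℕ.* x ≢ 1
  p*x≢1 x eq = ℕ.<⇒≢ 1<p (sym (ℕ.m*n≡1⇒m≡1 p x eq))

  p*-injective : ∀ {x y} → p ℕ.* x ≡ p ℕ.* y → x ≡ y
  p*-injective {x} {y} = ℕ.*-cancelˡ-≡ x y p {{ℕ.>-nonZero (ℕ.<-trans (s≤s z≤n) 1<p)}}

  multiplicity-1 : ∀ m {n} (s : Vec ℕ n) → multiplicity 1 (1^ m ++p· s) ≡ m
  multiplicity-1 zero    []      = refl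
  multiplicity-1 zero    (x ∷ s) = trans (count-reject (ℕ._≟ 1) (Vec.map (p ℕ.*_) s) (p*x≢1 x)) (multiplicity-1 zero s)
  multiplicity-1 (suc m) s       = trans (count-accept (ℕ._≟ 1) (1^ m ++p· s) refl) (cong suc (multiplicity-1 m s))

  -- Multiplication by p is injective, and since p > 1 no multiple of p is among the ones.
  multiplicity-p* : ∀ m {n} (s : Vec ℕ n) x → multiplicity (p ℕ.* x) (1^ m ++p· s) ≡ multiplicity x s
  multiplicity-p* zero    []      x = refl
  multiplicity-p* zero    (y ∷ s) x with multiplicity-p* zero s x | y ℕ.≟ x
  ... | ih | yes refl = trans (count-accept (ℕ._≟ p ℕ.* x) (Vec.map (p ℕ.*_) s) refl) (trans (cong suc ih) (sym (count-accept (ℕ._≟ x) s refl)))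
  ... | ih | no y≢x   = trans (count-reject (ℕ._≟ p ℕ.* x) (Vec.map (p ℕ.*_) s) (y≢x ∘ p*-injective)) (trans ih (sym (count-reject (ℕ._≟ x) s y≢x)))
  multiplicity-p* (suc m) s x = trans (count-reject (ℕ._≟ p ℕ.* x) (1^ m ++p· s) (p*x≢1 x ∘ sym)) (multiplicity-p* m s x)

  ∈-step⁻ : ∀ m {n} (s : Vec ℕ n) {a} → a ∈ 1^ m ++p· s → a ≡ 1 ⊎ ∃ λ x → x ∈ s × a ≡ p ℕ.* x
  ∈-step⁻ zero    (x ∷ s) (here a≡) = inj₂ (x , here refl , a≡)
  ∈-step⁻ zero    (_ ∷ s) (there a∈) with ∈-step⁻ zero s a∈
  ... | inj₁ a≡1            = inj₁ a≡1
  ... | inj₂ (x , x∈s , a≡) = inj₂ (x , there x∈s , a≡)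
  ∈-step⁻ (suc m) s (here a≡1) = inj₁ a≡1
  ∈-step⁻ (suc m) s (there a∈) = ∈-step⁻ m s a∈

  DistinctPowers : ∀ {n} → ℕ → Vec ℕ n → Set
  DistinctPowers e s = ∀ a → (a ∈ s) ⇔ (∃ λ i → i ≤ e × a ≡ p ^ i)

  PowerMultiplicities : ∀ {n} → ℕ → Vec ℕ n → Set
  PowerMultiplicities e s = ∀ i → i ≤ e → multiplicity (p ^ i) s ≡ φ (p ^ (e ∸ i))

  -- The ones supply p⁰, for which there must be at least one of them; scaling by p raises all other
  -- exponents by one.
  distinctPowers-step : ∀ {m n e} {s : Vec ℕ n} → 0 ℕ.< m → DistinctPowers e s → DistinctPowers (suc e) (1^ m ++p· s)
  distinctPowers-step {suc m} {e = e} {s} 0<m s-powers a = mk⇔ to from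
    where
    to : a ∈ 1^ suc m ++p· s → ∃ λ i → i ≤ suc e × a ≡ p ^ i
    to a∈ with ∈-step⁻ (suc m) s a∈
    ... | inj₁ a≡1 = 0 , z≤n , a≡1
    ... | inj₂ (x , x∈s , refl) with i , i≤e , refl ← Equivalence.to (s-powers x) x∈s = suc i , s≤s i≤e , refl
    from : (∃ λ i → i ≤ suc e × a ≡ p ^ i) → a ∈ 1^ suc m ++p· s
    from (zero  , _       , refl) = here refl
    from (suc i , s≤s i≤e , refl) =
      ∈-++⁺ʳ (Vec.replicate (suc m) 1) (∈-map⁺ (p ℕ.*_) (Equivalence.from (s-powers (p ^ i)) (i , i≤e , refl)))

  -- Exponent and bound rise together, so e - i and with it the prescribed multiplicity is
  -- unchanged; only p⁰ is new.
  multiplicities-step : ∀ {m n e} {s : Vec ℕ n} → m ≡ φ (p ^ suc e) → PowerMultiplicities e s →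
                        PowerMultiplicities (suc e) (1^ m ++p· s)
  multiplicities-step {m} {s = s} m≡φ s-mult zero    _         = trans (multiplicity-1 m s) m≡φ
  multiplicities-step {m} {s = s} m≡φ s-mult (suc i) (s≤s i≤e) = trans (multiplicity-p* m s (p ^ i)) (s-mult i i≤e)

module _ (p′ : ℕ) (p-prime : Prime (suc p′)) where

  open PrimePower p′ p-prime
  open Divisors p 1<p

  Smith : ∀ {k} → ℕ → Vec ℕ k → Set
  Smith e s = Chain s × A (p ^ e) ∼ diag (λ i → + lookup s i) × DistinctPowers e s × PowerMultiplicities e s

  smith : ∀ e → ∃ λ (s : Vec ℕ (p ^ e)) → Smith e s
  -- `A 1` is the 1 × 1 matrix with entry 1: the only summand is ℤ[X]/(X - 1), and X⁰ has remainder
  -- 1.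
  smith zero = 1 ∷ [] , (λ { zero zero _ → 1∣ 1 }) ,
    (𝟙 , 𝟙 , 𝟙-unimodular , 𝟙-unimodular , λ { zero zero → refl }) ,
    (λ a → mk⇔ (λ { (here a≡1) → 0 , z≤n , a≡1 }) (λ { (zero , _ , a≡1) → here a≡1 })) ,
    λ { zero _ → refl }
  -- The diagonal is built with length m + pᵉ, whereas `p ^ suc e` computes to pᵉ + m.
  smith (suc e) = resize (ℕ.+-comm m (p ^ e)) (extend (smith e))
    where
    m = p′ ℕ.* p ^ e
    0<m : 0 ℕ.< m
    0<m = ℕ.*-mono-≤ (ℕ.s≤s⁻¹ 1<p) (ℕ.m^n>0 p e)
    extend : (∃ λ (s : Vec ℕ (p ^ e)) → Smith e s) → ∃ λ (s : Vec ℕ (m ℕ.+ p ^ e)) → Smith (suc e) s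
    extend (s , s-chain , A∼s , s-powers , s-mult) =
      1^ m ++p· s ,
      chain-step m s-chain ,
      ∼-respʳ-≈ {M = A (p ^ suc e)} (block-step m s) (∼-trans {L = A (p ^ suc e)} (Step.A-∼ p′ p-prime e) (block-∼ (∼-scale A∼s (+ p)))) ,
      distinctPowers-step 0<m s-powers ,
      multiplicities-step (sym (φ-p^ e)) s-mult
    resize : ∀ {k l} → k ≡ l → (∃ λ (s : Vec ℕ k) → Smith (suc e) s) → ∃ λ (s : Vec ℕ l) → Smith (suc e) s
    resize refl s = s

theorem2p6 : (p e : ℕ) → Prime p → e > 0 →
    (∃ λ (s : Vec ℕ (p ^ e)) → IsElementaryDivisors (A (p ^ e)) s) ×
    ((s : Vec ℕ (p ^ e)) → IsElementaryDivisors (A (p ^ e)) s →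
    (∀ a → (a ∈ s) ⇔ (∃ λ i → i ≤ e × a ≡ p ^ i)) ×
    (∀ i → i ≤ e → multiplicity (p ^ i) s ≡ φ (p ^ (e ∸ i))))
theorem2p6 zero     e p-prime _ = contradiction p-prime ¬prime[0]
theorem2p6 (suc p′) e p-prime _ = from (smith p′ p-prime e)
  where
  from : (∃ λ (t : Vec ℕ (suc p′ ^ e)) → Smith p′ p-prime e t) → _
  from (t , t-chain , A∼t , t-powers , t-mult) = (t , t-chain , A∼t) , λ s s-divisors →
    -- Both properties hold for the constructed `t`, and by uniqueness an arbitrary Smith diagonal
    -- `s` equals `t`.
    subst (λ s → (∀ a → (a ∈ s) ⇔ (∃ λ i → i ≤ e × a ≡ suc p′ ^ i)) × (∀ i → i ≤ e → multiplicity (suc p′ ^ i) s ≡ φ (suc p′ ^ (e ∸ i))))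
      (elementaryDivisors-unique {M = A (suc p′ ^ e)} (t-chain , A∼t) s-divisors) (t-powers , t-mult)
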